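{- Let $Q$ be an $n$-element poset of width $2$. If $Q\in\mathcal{Q}$, then there exists a constant $C$, depending only on $Q$, such that $\mathrm{FF}(w,Q)\le 2^{C(\lg w)^2}$ for every positive integer $w$; in fact $C=O(n)$ suffices, i.e. there is an absolute constant $K$ (independent of $Q$, $n$ and $w$) such that one may take $C\le Kn$. If $Q\notin\mathcal{Q}$, then $\mathrm{FF}(w,Q)\ge 2^w-1$ for every positive integer $w$.
   Context: All posets are finite. The width of a poset is the size of a maximum antichain. A poset $Q$ is a subposet of $P$ if (a poset isomorphic to) $Q$ can be obtained from $P$ by deleting elements, i.e. $Q$ is isomorphic to an induced suborder of $P$; $P$ is $Q$-free if $Q$ is not a subposet of $P$. $\lg$ is the base-2 logarithm. First-Fit: the elements of a poset $P$ are processed one at a time in a given presentation order. If $\{x_1,\ldots,x_{k-1}\}$ has already been partitioned into chains $(C_1,\ldots,C_t)$, then $x_k$ is added to the first chain $C_j$ such that $C_j\cup\{x_k\}$ is a chain; if there is no such $j$, a new chain $C_{t+1}=\{x_k\}$ is introduced. $\mathrm{FF}(w,Q)$ is the maximum, over all $Q$-free posets $P$ of width $w$ and all presentation orders of $P$, of the number of chains that First-Fit uses (with value $\infty$ if unbounded, and $0$ if there is no such $P$). A poset is ladder-like if its elements can be partitioned into two chains $C_1$ and $C_2$ (one of which may be empty) such that if $(x,y)\in C_1\times C_2$ and $x$ is comparable to $y$, then $x<y$. The series composition of posets $S_1,\ldots,S_n$ is the poset consisting of disjoint copies of $S_1,\ldots,S_n$, each with its own order, arranged so that $x<y$ whenever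 $x\in S_i$, $y\in S_j$ and $i<j$. $\mathcal{Q}$ is the minimal family of posets (closed under isomorphism) that contains the ladder-like posets and is closed under series composition. -}

module Defs where

open import Data.Bool using (if_then_else_)
open import Data.Fin as Fin using (Fin)
open import Data.Fin.Permutation using (Permutation′; _⟨$⟩ʳ_)
open import Data.Fin.Properties using (all?)
open import Data.Fin.Subset using (Subset; _∈_; _∉_; _∪_; ⁅_⁆; ∁; ∣_∣)
open import Data.Fin.Subset.Properties using (_∈?_)
open import Data.List using (List; []; _∷_; foldl; length; tabulate)
open import Data.Nat using (ℕ; _≤_; _*_; _^_; NonZero)
open import Data.Product using (Σ; ∃; ∃-syntax; _×_; _,_)
open import Data.Sum using (_⊎_)
open import Level using (0ℓ)
open import Relation.Binary using (Rel; IsDecPartialOrder)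
open import Relation.Binary.Morphism.Structures using (IsOrderMonomorphism; IsOrderIsomorphism)
open import Relation.Binary.PropositionalEquality using (_≡_; _≢_)
open import Relation.Nullary using (¬_; Dec; does)
open import Relation.Nullary.Decidable using (_⊎-dec_; _→-dec_)

record FinPoset (n : ℕ) : Set₁ where
  infix 4 _≼_ _≺_
  field
    _≼_               : Rel (Fin n) 0ℓ
    isDecPartialOrder : IsDecPartialOrder _≡_ _≼_

  open IsDecPartialOrder isDecPartialOrder public using () renaming (_≤?_ to _≼?_)

  _≺_ : Rel (Fin n) 0ℓ
  x ≺ y = x ≼ y × x ≢ y

  Comparable : Rel (Fin n) 0ℓ
  Comparable x y = x ≼ y ⊎ y ≼ x

  IsChain : Subset n → Set
  IsChain S = ∀ x y → x ∈ S → y ∈ S → Comparable x y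

  IsAntichain : Subset n → Set
  IsAntichain S = ∀ x y → x ∈ S → y ∈ S → x ≢ y → ¬ Comparable x y

  HasWidth : ℕ → Set
  HasWidth w = (∃[ A ] IsAntichain A × ∣ A ∣ ≡ w) × (∀ A → IsAntichain A → ∣ A ∣ ≤ w)

  LadderLike : Set
  LadderLike = ∃[ C₁ ] IsChain C₁ × IsChain (∁ C₁) ×
               (∀ x y → x ∈ C₁ → y ∈ ∁ C₁ → Comparable x y → x ≺ y)

  isChain? : ∀ S → Dec (IsChain S)
  isChain? S = all? λ x → all? λ y →
    (x ∈? S) →-dec (y ∈? S) →-dec ((x ≼? y) ⊎-dec (y ≼? x))

  insert : List (Subset n) → Fin n → List (Subset n)
  insert []       x = ⁅ x ⁆ ∷ []
  insert (C ∷ Cs) x =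
    if does (isChain? (C ∪ ⁅ x ⁆)) then (C ∪ ⁅ x ⁆) ∷ Cs else C ∷ insert Cs x

  -- The presentation order is π 0, π 1, …, π (n - 1).
  firstFit : Permutation′ n → List (Subset n)
  firstFit π = foldl insert [] (tabulate (π ⟨$⟩ʳ_))

open FinPoset public using (HasWidth; LadderLike; firstFit)

infix 4 _⊑_

_⊑_ : ∀ {m n} → FinPoset m → FinPoset n → Set
Q ⊑ P = ∃[ f ] IsOrderMonomorphism _≡_ _≡_ (FinPoset._≼_ Q) (FinPoset._≼_ P) f

_-Free : ∀ {m n} → FinPoset m → FinPoset n → Set
(Q -Free) P = ¬ (Q ⊑ P)

module _ {k : ℕ} {s : Fin k → ℕ} (S : ∀ i → FinPoset (s i)) where

  data SeriesOrder : Rel (Σ (Fin k) λ i → Fin (s i)) 0ℓ where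
    within : ∀ {i x y} → FinPoset._≼_ (S i) x y → SeriesOrder (i , x) (i , y)
    across : ∀ {i j x y} → i Fin.< j → SeriesOrder (i , x) (j , y)

  IsSeriesComposition : ∀ {n} → FinPoset n → Set
  IsSeriesComposition P =
    ∃[ f ] IsOrderIsomorphism _≡_ _≡_ SeriesOrder (FinPoset._≼_ P) f

-- Closure under isomorphism is the case k = 1 of series.
data 𝒬 {n : ℕ} (P : FinPoset n) : Set₁ where
  ladder : LadderLike P → 𝒬 P
  series : ∀ {k} {s : Fin k → ℕ} (S : ∀ i → FinPoset (s i)) →
           (∀ i → 𝒬 (S i)) → IsSeriesComposition S P → 𝒬 P

infix 4 _≤FF[_,_]

-- FF(w , Q) ∈ ℕ ∪ {∞} is represented by the set of all m with m ≤ FF(w , Q).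
-- The constructor zero makes the value 0 when no poset qualifies; the value is
-- ∞ when every m belongs to the set.
data _≤FF[_,_] {n : ℕ} (m w : ℕ) (Q : FinPoset n) : Set₁ where
  zero     : m ≡ 0 → m ≤FF[ w , Q ]
  attained : ∀ {N} (P : FinPoset N) (π : Permutation′ N) →
             HasWidth P w → (Q -Free) P → m ≤ length (firstFit P π) →
             m ≤FF[ w , Q ]

infix 4 _≤2^[_·lg²_]

-- The real inequality m ≤ 2^(C (lg w)²), for w ≥ 1.  The rationals p / q ≥ lg w are
-- those with w ^ q ≤ 2 ^ p; since lg w ≥ 0 is their infimum and r ↦ 2^(C r²) is
-- continuous and nondecreasing on r ≥ 0, the inequality holds exactly when
-- m ≤ 2^(C (p / q)²) for all of them; raise both sides to the power q².
_≤2^[_·lg²_] : ℕ → ℕ → ℕ → Set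
m ≤2^[ C ·lg² w ] =
  ∀ p q .{{_ : NonZero q}} → w ^ q ≤ 2 ^ p → m ^ (q * q) ≤ 2 ^ (C * (p * p))

{-# OPTIONS --safe #-}
module Submission where

-- Upper bound.  A First-Fit outcome is a family of chains D j in which every element of D j has
-- an incomparable element in each D l with l < j.  Two facts suffice.
--
-- (1) A convex window W meeting many classes contains a large such family: an element of
-- W ∩ D j with no incomparable element in W ∩ D l (l < j) lies above or below all of W ∩ D l,
-- and a long sequence of such pairs yields a ladder, whose second side consists of witnesses
-- outside W.  Two mutually incomparable windows cannot both be wide, so they cannot
-- both meet many classes.  Applied on a long chain of witnesses to {u ∥ y, u ∥ z} against
-- {y < u < z}, this shows that for most colours the witnesses stay between the ends of the
-- chain, so an antichain can be grown one element at a time at a cost polynomial in the bound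
-- for half the width.  This bounds First-Fit on ladder-free posets by w^O(log w).
--
-- (2) If P is the union of a down-set and an up-set, the bounds b₁ and b₂ for the two parts give
-- b + 1 ≤ (b₁ + 1)(b₂ + 1) for P.  A poset without a series composition of ladders is cut in
-- this way into ladder-free levels, according to how many of the ladders fit below an element.
--
-- Lower bound.  Given a poset of width w with a greedy colouring by b colours, stack b + 1 copies
-- of it beside a chain whose j-th element lies above exactly the first j copies.  Each copy
-- trades the colours of the chain elements incomparable to it for new ones, which brings the
-- number of colours to 2b + 1.  All subposets of width 2 of the resulting posets lie in 𝒬.

open import Defs
open import Data.Bool using (if_then_else_)
open import Data.Empty using (⊥; ⊥-elim)
open import Data.Fin as Fin using (Fin; toℕ)
open import Data.Fin.Permutation using (Permutation′; _⟨$⟩ʳ_) renaming (id to idₚ)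
import Data.Fin.Properties as Finₚ
open import Data.Fin.Subset using (Subset; inside; outside; ∁; _∪_; ⁅_⁆; ∣_∣) renaming (_∈_ to _∈ₛ_)
open import Data.Fin.Subset.Properties using (_∈?_; x∉p⇒x∈∁p; x∈∁p⇒x∉p; x∈p∪q⁺; x∈p∪q⁻; x∈⁅x⁆; x∈⁅y⁆⇒x≡y; ∉⊥)
open import Data.List using (List; []; _∷_; _++_; length; map; filter; take; drop; lookup; reverse; concat; foldr; foldl; tabulate; allFin; upTo; downFrom; cartesianProductWith)
open import Data.List.Membership.Propositional using (_∈_; find; lose)
open import Data.List.Membership.Propositional.Properties using (∈-filter⁺; ∈-filter⁻; ∈-++⁺ˡ; ∈-++⁺ʳ; ∈-map⁺; ∈-map⁻; ∈-concat⁺′; ∈-lookup; ∈-allFin; ∈-upTo⁺; ∈-downFrom⁻; ∈-cartesianProductWith⁺; ∈-cartesianProductWith⁻)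
open import Data.List.Properties using (++-assoc; ++-identityʳ; length-++; length-map; length-take; length-drop; length-reverse; length-tabulate; length-downFrom)
open import Data.List.Relation.Unary.All as All using (All; []; _∷_; all?)
import Data.List.Relation.Unary.All.Properties as Allₚ
open import Data.List.Relation.Unary.AllPairs as AllPairs using (AllPairs; []; _∷_)
import Data.List.Relation.Unary.AllPairs.Properties as AllPairsₚ
open import Data.List.Relation.Unary.Any as Any using (Any; here; there; any?)
import Data.List.Relation.Unary.Any.Properties as Anyₚ
open import Data.List.Relation.Unary.Linked using (Linked; []; [-]; _∷_)
open import Data.List.Relation.Unary.Linked.Properties using (Linked⇒AllPairs)
open import Data.List.Relation.Unary.Unique.Propositional using (Unique)
open import Data.List.Relation.Unary.Unique.Propositional.Properties using (map⁺; ++⁺; allFin⁺; cartesianProductWith⁺)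
open import Data.Nat using (ℕ; zero; suc; _+_; _*_; _^_; _∸_; _⊓_; _≤_; _<_; _>_; z≤n; s≤s; _≤?_; _<?_; _≟_)
open import Data.Nat.Properties
open import Data.Nat.Tactic.RingSolver using (solve-∀)
open import Data.Product using (Σ; ∃; ∃-syntax; _×_; _,_; proj₁; proj₂)
open import Data.Sum using (_⊎_; inj₁; inj₂; [_,_]′)
open import Data.Unit using (⊤; tt)
open import Data.Vec using ([]; _∷_; here; there)
open import Function using (_∘_; flip; id; case_of_)
open import Level using (0ℓ)
open import Relation.Binary using (Rel; Decidable; Reflexive; Transitive; IsDecPartialOrder; tri<; tri≈; tri>)
open import Relation.Binary.Morphism.Structures using (IsOrderMonomorphism; IsOrderIsomorphism)
open import Relation.Binary.PropositionalEquality using (_≡_; _≢_; refl; sym; trans; cong; cong₂; subst; subst₂; isEquivalence)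
open import Relation.Nullary using (¬_; Dec; yes; no; ¬?; contradiction; does)
open import Relation.Nullary.Decidable using (_×-dec_; _⊎-dec_; decidable-stable)
open import Relation.Unary using (Pred) renaming (Decidable to Decidable₁)

-- Lists, counting and Mirsky's theorem.

AllPairs-lookup : ∀ {A : Set} {S : Rel A 0ℓ} {xs x y} → AllPairs S xs → x ∈ xs → y ∈ xs →
                  x ≡ y ⊎ S x y ⊎ S y x
AllPairs-lookup (_ ∷ _)   (here refl) (here refl) = inj₁ refl
AllPairs-lookup (ss ∷ _)  (here refl) (there y∈)  = inj₂ (inj₁ (All.lookup ss y∈))
AllPairs-lookup (ss ∷ _)  (there x∈)  (here refl) = inj₂ (inj₂ (All.lookup ss x∈))
AllPairs-lookup (_ ∷ ps)  (there x∈)  (there y∈)  = AllPairs-lookup ps x∈ y∈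

AllPairs-build : ∀ {A : Set} {S T : Rel A 0ℓ} {xs} →
                 (∀ {x y} → x ∈ xs → y ∈ xs → S x y → T x y) → AllPairs S xs → AllPairs T xs
AllPairs-build f []       = []
AllPairs-build f (s ∷ ss) =
  All.tabulate (λ y∈ → f (here refl) (there y∈) (All.lookup s y∈)) ∷
  AllPairs-build (λ x∈ y∈ → f (there x∈) (there y∈)) ss

AllPairs-reverse : ∀ {A : Set} {S : Rel A 0ℓ} {xs} → AllPairs S xs → AllPairs (flip S) (reverse xs)
AllPairs-reverse {S = S} {xs} ss = go ss [] (All.universal (λ _ → []) xs)
  where
  go : ∀ {xs acc} → AllPairs S xs → AllPairs (flip S) acc → All (λ x → All (λ a → S a x) acc) xs →
       AllPairs (flip S) (Data.List.foldl (flip _∷_) acc xs)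
  go []       as _         = as
  go (s ∷ ss) as (c ∷ cs) = go ss (c ∷ as) (All.zipWith (λ (p , q) → p ∷ q) (s , cs))

Unique-lookup-injective : ∀ {A : Set} {xs : List A} → Unique xs → ∀ {i j} → lookup xs i ≡ lookup xs j → i ≡ j
Unique-lookup-injective (_ ∷ _)  {Fin.zero}  {Fin.zero}  _  = refl
Unique-lookup-injective (u ∷ _)  {Fin.zero}  {Fin.suc j} eq = contradiction eq (All.lookup u (∈-lookup j))
Unique-lookup-injective (u ∷ _)  {Fin.suc i} {Fin.zero}  eq = contradiction (sym eq) (All.lookup u (∈-lookup i))
Unique-lookup-injective (_ ∷ us) {Fin.suc i} {Fin.suc j} eq = cong Fin.suc (Unique-lookup-injective us eq)

Unique-length-≤ : ∀ {A : Set} {xs ys : List A} → Unique xs → (∀ {x} → x ∈ xs → x ∈ ys) → length xs ≤ length ys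
Unique-length-≤ {xs = xs} {ys} u sub = Finₚ.injective⇒≤ {f = pos} λ {i} {j} eq →
  Unique-lookup-injective u (trans (at i) (trans (cong (lookup ys) eq) (sym (at j))))
  where
  pos : Fin (length xs) → Fin (length ys)
  pos i = Any.index (sub (∈-lookup i))
  at : ∀ i → lookup xs i ≡ lookup ys (pos i)
  at i = Anyₚ.lookup-index (sub (∈-lookup i))

length-filter-¬ : ∀ {A : Set} {P : Pred A 0ℓ} (P? : Decidable₁ P) xs →
                  length xs ≡ length (filter P? xs) + length (filter (¬? ∘ P?) xs)
length-filter-¬ P? []       = refl
length-filter-¬ P? (x ∷ xs) with P? x
... | yes _ = cong suc (length-filter-¬ P? xs)
... | no _  = trans (cong suc (length-filter-¬ P? xs)) (sym (+-suc _ _))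

-- Only consecutive elements are related, since `mirsky` assumes no transitivity of R. Where R is
-- transitive, `Linked⇒AllPairs` supplies the remaining pairs.
record ChainIn {A : Set} (R : Rel A 0ℓ) (xs : List A) (n : ℕ) : Set where
  constructor mkChain
  field
    elems    : List A
    linked   : Linked R elems
    members  : All (_∈ xs) elems
    length-≡ : length elems ≡ n

-- S is an ambient relation on the list, such as the decreasing order of colours, which survives the
-- passage to a sublist.
record AntichainIn {A : Set} (R S : Rel A 0ℓ) (xs : List A) (b : ℕ) : Set where
  constructor mkAntichain
  field
    elems       : List A
    independent : ∀ {x y} → x ∈ elems → y ∈ elems → ¬ R x y
    members     : ∀ {x} → x ∈ elems → x ∈ xs
    pairs       : AllPairs S elems
    large       : b < length elems

-- Peel off the R-minimal elements a times: either one of the layers is large,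
-- or an element survives and can be traced back down through all the layers.
mirsky : ∀ {A : Set} {R S : Rel A 0ℓ} → Decidable R → ∀ a b xs → AllPairs S xs → a * b < length xs →
         ChainIn R xs (suc a) ⊎ AntichainIn R S xs b
mirsky R? zero b (x ∷ xs) ss lt = inj₁ (mkChain (x ∷ []) [-] (here refl ∷ []) refl)
mirsky {A} {R} {S} R? (suc a) b xs ss lt = split (b <? length mins)
  where
  Minimal? : Decidable₁ (λ x → All (λ y → ¬ R y x) xs)
  Minimal? x = all? (λ y → ¬? (R? y x)) xs
  mins rest : List A
  mins = filter Minimal? xs
  rest = filter (¬? ∘ Minimal?) xs
  extend : ChainIn R rest (suc a) → ChainIn R xs (suc (suc a))
  extend (mkChain (y ∷ ys) l (m ∷ ms) eq)
    with find (Allₚ.¬All⇒Any¬ (λ z → ¬? (R? z y)) xs (proj₂ (∈-filter⁻ (¬? ∘ Minimal?) {xs = xs} m)))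
  ... | z , z∈ , ¬¬r = mkChain (z ∷ y ∷ ys) (decidable-stable (R? z y) ¬¬r ∷ l)
                               (z∈ ∷ All.map (proj₁ ∘ ∈-filter⁻ (¬? ∘ Minimal?)) (m ∷ ms)) (cong suc eq)
  split : Dec (b < length mins) → ChainIn R xs (suc (suc a)) ⊎ AntichainIn R S xs b
  split (yes b<) = inj₂ (mkAntichain mins
    (λ x∈ y∈ → All.lookup (proj₂ (∈-filter⁻ Minimal? {xs = xs} y∈)) (proj₁ (∈-filter⁻ Minimal? x∈)))
    (proj₁ ∘ ∈-filter⁻ Minimal?) (AllPairsₚ.filter⁺ Minimal? ss) b<)
  split (no b≮)
    with mirsky R? a b rest (AllPairsₚ.filter⁺ (¬? ∘ Minimal?) ss)
           (+-cancelˡ-< b _ _ (≤-trans lt (≤-trans (≤-reflexive (length-filter-¬ Minimal? xs)) (+-monoˡ-≤ _ (≮⇒≥ b≮)))))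
  ... | inj₁ c = inj₁ (extend c)
  ... | inj₂ (mkAntichain ys anti sub ps len) =
    inj₂ (mkAntichain ys anti (proj₁ ∘ ∈-filter⁻ (¬? ∘ Minimal?) ∘ sub) ps len)

-- Preorders, ladders and First-Fit outcomes.

record DecPreorder (A : Set) : Set₁ where
  infix 4 _≼_ _≼?_ _≺_ _≺?_ _∥_ _∥?_
  field
    _≼_     : Rel A 0ℓ
    ≼-refl  : Reflexive _≼_
    ≼-trans : Transitive _≼_
    _≼?_    : Decidable _≼_

  _≺_ _∥_ : Rel A 0ℓ
  x ≺ y = x ≼ y × ¬ y ≼ x
  x ∥ y = ¬ x ≼ y × ¬ y ≼ x

  _≺?_ : Decidable _≺_
  x ≺? y = (x ≼? y) ×-dec ¬? (y ≼? x)

  _∥?_ : Decidable _∥_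
  x ∥? y = ¬? (x ≼? y) ×-dec ¬? (y ≼? x)

  ∥-sym : ∀ {x y} → x ∥ y → y ∥ x
  ∥-sym (p , q) = q , p

  ≺-trans : Transitive _≺_
  ≺-trans (p , q) (r , s) = ≼-trans p r , λ t → q (≼-trans r t)

  ¬∥⇒comparable : ∀ {x y} → ¬ x ∥ y → x ≼ y ⊎ y ≼ x
  ¬∥⇒comparable {x} {y} ¬p with x ≼? y | y ≼? x
  ... | yes p | _     = inj₁ p
  ... | no _  | yes q = inj₂ q
  ... | no p  | no q  = contradiction (p , q) ¬p

  Convex : Pred A 0ℓ → Set
  Convex W = ∀ {x y z} → x ≼ y → y ≼ z → W x → W z → W y

  Width : Pred A 0ℓ → ℕ → Set
  Width S w = ∀ ys → All S ys → AllPairs _∥_ ys → length ys ≤ w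

  Step : Rel (A × A) 0ℓ
  Step (l , h) (l′ , h′) = l ≼ l′ × ¬ l′ ≼ h × h ≼ h′

  -- The rungs (xᵢ , yᵢ) of a ladder x₁ < x₂ < ⋯, y₁ < y₂ < ⋯ with xᵢ ≤ yⱼ iff i ≤ j.
  record IsLadder (rs : List (A × A)) : Set where
    field
      rungs   : All (λ (l , h) → l ≼ h) rs
      steps   : AllPairs Step rs
      upwards : ∀ {p q} → p ∈ rs → q ∈ rs → ¬ proj₂ p ≼ proj₁ q

  -- Excluding the single length m suffices, because every longer ladder has a prefix of m rungs.
  LadderFree : Pred A 0ℓ → ℕ → Set
  LadderFree S m = ∀ rs → All (λ (l , h) → S l × S h) rs → IsLadder rs → length rs ≢ m

  -- A First-Fit outcome, with the classes D j for the colours j in J; disjointness of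
  -- the classes follows from the witnesses.
  record Grundy (J : List ℕ) (D : ℕ → List A) : Set where
    field
      decreasing : AllPairs _>_ J
      chain      : ∀ {j x y} → j ∈ J → x ∈ D j → y ∈ D j → x ≼ y ⊎ y ≼ x
      inhabited  : ∀ {j} → j ∈ J → ∃[ x ] x ∈ D j
      witness    : ∀ {j l x} → j ∈ J → l ∈ J → l < j → x ∈ D j → ∃[ y ] y ∈ D l × x ∥ y

open DecPreorder using (Grundy; IsLadder)

dual : ∀ {A} → DecPreorder A → DecPreorder A
dual O = record { _≼_ = flip _≼_ ; ≼-refl = ≼-refl ; ≼-trans = flip ≼-trans ; _≼?_ = flip _≼?_ }
  where open DecPreorder O

module _ {A : Set} (O : DecPreorder A) where
  open DecPreorder O hiding (Grundy; IsLadder)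

  Grundy-dual : ∀ {J D} → Grundy O J D → Grundy (dual O) J D
  Grundy-dual g = record
    { decreasing = decreasing
    ; chain      = λ j∈ x∈ y∈ → chain j∈ y∈ x∈
    ; inhabited  = inhabited
    ; witness    = λ j∈ l∈ l<j x∈ → let (y , y∈ , p) = witness j∈ l∈ l<j x∈ in y , y∈ , ∥-sym p
    } where open Grundy g

  Width-dual : ∀ {S w} → Width S w → DecPreorder.Width (dual O) S w
  Width-dual wd ys ss ps = wd ys ss (AllPairs.map ∥-sym ps)

  LadderFree-dual : ∀ {S m} → LadderFree S m → DecPreorder.LadderFree (dual O) S m
  LadderFree-dual {S} free rs ss lad len =
    free (reverse (map swap′ rs))
      (All.tabulate λ p∈ → let (l , h) , q∈ , e = inv p∈ in
        subst (λ (l , h) → S l × S h) (sym e) (proj₂ (All.lookup ss q∈) , proj₁ (All.lookup ss q∈)))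
      record
        { rungs   = All.tabulate λ p∈ → let q , q∈ , e = inv p∈ in
                      subst (λ (l , h) → l ≼ h) (sym e) (All.lookup rungs q∈)
        ; steps   = AllPairs-reverse (AllPairsₚ.map⁺ (AllPairs.map (λ (a , b , c) → c , b , a) steps))
        ; upwards = λ p∈ q∈ → let p′ , p′∈ , e = inv p∈ ; q′ , q′∈ , e′ = inv q∈ in
                      subst₂ (λ p q → ¬ proj₂ p ≼ proj₁ q) (sym e) (sym e′) (upwards q′∈ p′∈)
        }
      (trans (length-reverse (map swap′ rs)) (trans (length-map swap′ rs) len))
    where
    open IsLadder lad
    swap′ : A × A → A × A
    swap′ (l , h) = h , l
    inv : ∀ {p} → p ∈ reverse (map swap′ rs) → ∃[ q ] q ∈ rs × p ≡ swap′ q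
    inv p∈ = ∈-map⁻ swap′ (Anyₚ.reverse⁻ p∈)

-- Convex windows and the ladders they force.

module Window {A : Set} (O : DecPreorder A) {W : Pred A 0ℓ} (W? : Decidable₁ W) (D : ℕ → List A) where
  open DecPreorder O hiding (Grundy; IsLadder)

  cut : ℕ → List A
  cut j = filter W? (D j)

  Meets : ℕ → Set
  Meets j = Any W (D j)

  Meets? : Decidable₁ Meets
  Meets? j = any? W? (D j)

  meets-cut : ∀ {j} → Meets j → ∃[ x ] x ∈ cut j
  meets-cut m = let x , x∈ , wx = find m in x , ∈-filter⁺ W? x∈ wx

  -- The obstruction to restricting a family to W: an element above the whole of `cut l` can have
  -- its witness in `D l` only outside W. The obstruction from below is `Over` in the dual order.
  Over : Rel ℕ 0ℓ
  Over j l = l < j × Any (λ y → All (_≺ y) (cut l)) (cut j)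

  Over? : Decidable Over
  Over? j l = (l <? j) ×-dec any? (λ y → all? (_≺? y) (cut l)) (cut j)

module _ {A : Set} (O : DecPreorder A) {W : Pred A 0ℓ} (W? : Decidable₁ W) (convex : DecPreorder.Convex O W)
         {J : List ℕ} {D : ℕ → List A} (g : Grundy O J D)
         {S : Pred A 0ℓ} (inS : ∀ {j x} → j ∈ J → x ∈ D j → S x) where
  open DecPreorder O hiding (Grundy; IsLadder)
  open Window O W? D
  open Grundy g

  private
    Descending : Rel (A × A) 0ℓ
    Descending (l , h) (l′ , h′) = l′ ≼ l × ¬ l ≼ h′

    Rung : Pred (A × A) 0ℓ
    Rung (l , h) = W l × ¬ W h × l ≼ h × S l × S h

  -- The rungs collected along an `Over`-chain, the highest first: each foot lies in W, and its head
  -- is a witness outside W in the same class. The field `below` is the invariant that makes the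
  -- next pair satisfy `Descending`.
  record Staircase (j n : ℕ) : Set where
    constructor mkStaircase
    field
      top        : A
      top∈       : top ∈ cut j
      steps      : List (A × A)
      length-≡   : length steps ≡ n
      rungs      : All Rung steps
      descending : AllPairs Descending steps
      below      : All (λ (l , h) → l ≼ top × ¬ top ≼ h) steps

  staircase : ∀ j js → Linked Over (j ∷ js) → All (λ i → i ∈ J × Meets i) (j ∷ js) → Staircase j (length js)
  staircase j [] _ ((_ , m) ∷ []) = mkStaircase (proj₁ (meets-cut m)) (proj₂ (meets-cut m)) [] refl [] [] []
  staircase j (i ∷ js) ((i<j , over) ∷ ls) ((j∈ , _) ∷ ms@((i∈ , _) ∷ _))
    with find over | staircase i js ls ms
  ... | y , y∈ , y-over | mkStaircase t t∈ rs len rungs desc below =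
    mkStaircase y y∈ ((t , v) ∷ rs) (cong suc len)
      ((proj₂ t∈D , v∉W , t≼v , inS i∈ (proj₁ t∈D) , inS i∈ v∈) ∷ rungs)
      (below ∷ desc)
      ((proj₁ t≺y , proj₁ y∥v) ∷ All.map (λ (a , b) → ≼-trans a (proj₁ t≺y) , λ y≼h → b (≼-trans (proj₁ t≺y) y≼h)) below)
    where
    t≺y : t ≺ y
    t≺y = All.lookup y-over t∈
    t∈D : t ∈ D i × W t
    t∈D = ∈-filter⁻ W? t∈
    wit : ∃[ z ] z ∈ D i × y ∥ z
    wit = witness j∈ i∈ i<j (proj₁ (∈-filter⁻ W? {xs = D j} y∈))
    v : A
    v = proj₁ wit
    v∈ : v ∈ D i
    v∈ = proj₁ (proj₂ wit)
    y∥v : y ∥ v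
    y∥v = proj₂ (proj₂ wit)
    -- Inside W, v would belong to `cut i` and hence lie below y.
    v∉W : ¬ W v
    v∉W wv = proj₂ y∥v (proj₁ (All.lookup y-over (∈-filter⁺ W? v∈ wv)))
    t≼v : t ≼ v
    t≼v with chain i∈ (proj₁ t∈D) v∈
    ... | inj₁ p = p
    ... | inj₂ p = contradiction (≼-trans p (proj₁ t≺y)) (proj₂ y∥v)

  -- The chain of μ * w + 2 colours gives μ * w + 1 rungs. Among their heads there are either μ + 1
  -- in strictly increasing order, which is a ladder, or an antichain of more than w. Convexity
  -- keeps heads from lying below feet, as heads are outside W and feet inside.
  no-long-Over-chain : ∀ {w μ} → Width S w → LadderFree S (suc μ) →
                       ¬ ChainIn Over (filter Meets? J) (suc (suc (μ * w)))
  no-long-Over-chain {w} {μ} width free (mkChain (j ∷ js) ls ms len)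
    with staircase j js ls (All.map (∈-filter⁻ Meets?) ms)
  ... | mkStaircase _ _ rs len′ rungs desc _
    with mirsky (λ p q → proj₂ p ≺? proj₂ q) μ w rs desc
           (≤-reflexive (trans (sym (suc-injective len)) (sym len′)))
  ... | inj₁ (mkChain cs links cs⊆ len″) =
    free cs (All.map (λ p∈ → let _ , _ , _ , sl , sh = rung p∈ in sl , sh) cs⊆)
      record
        { rungs   = All.map (λ p∈ → let _ , _ , l≼h , _ = rung p∈ in l≼h) cs⊆
        ; steps   = AllPairs-build (λ p∈ q∈ → step (All.lookup cs⊆ p∈) (All.lookup cs⊆ q∈))
                      (Linked⇒AllPairs (λ a b → ≺-trans a b) links)
        ; upwards = λ p∈ q∈ h≼l →
            let _ , ¬wh , l≼h , _ = rung (All.lookup cs⊆ p∈) ; wl , _ = rung (All.lookup cs⊆ q∈)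
                wl′ , _ = rung (All.lookup cs⊆ p∈)
            in ¬wh (convex l≼h h≼l wl′ wl)
        } len″
    where
    rung : ∀ {p} → p ∈ rs → Rung p
    rung = All.lookup rungs
    step : ∀ {p q} → p ∈ rs → q ∈ rs → proj₂ p ≺ proj₂ q → Step p q
    -- A rung with a smaller head must come later in the staircase, so along the rising heads the
    -- feet rise as well.
    step p∈ q∈ h≺h′ with AllPairs-lookup desc p∈ q∈
    ... | inj₁ refl           = contradiction (proj₁ h≺h′) (proj₂ h≺h′)
    ... | inj₂ (inj₁ (_ , b)) = contradiction (≼-trans (proj₁ (proj₂ (proj₂ (rung p∈)))) (proj₁ h≺h′)) b
    ... | inj₂ (inj₂ (a , b)) = a , b , proj₁ h≺h′
  ... | inj₂ (mkAntichain as indep as⊆ desc′ w<) =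
    <⇒≱ (subst (w <_) (sym (length-map proj₂ as)) w<)
      (width (map proj₂ as)
        (Allₚ.map⁺ (All.tabulate λ p∈ → let _ , _ , _ , _ , sh = All.lookup rungs (as⊆ p∈) in sh))
        (AllPairsₚ.map⁺ (AllPairs-build incomparable desc′)))
    where
    incomparable : ∀ {p q} → p ∈ as → q ∈ as → Descending p q → proj₂ p ∥ proj₂ q
    incomparable {p} {q} p∈ q∈ (_ , b) = (λ h≼h′ → b (≼-trans l≼h h≼h′)) , λ h′≼h → indep q∈ p∈ (h′≼h , λ h≼h′ → b (≼-trans l≼h h≼h′))
      where
      l≼h : proj₁ p ≼ proj₂ p
      l≼h = proj₁ (proj₂ (proj₂ (All.lookup rungs (as⊆ p∈))))

-- Large First-Fit families inside a window.

module _ {A : Set} (O : DecPreorder A) {W : Pred A 0ℓ} (W? : Decidable₁ W) (convex : DecPreorder.Convex O W)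
         {J : List ℕ} {D : ℕ → List A} (g : Grundy O J D) where
  open DecPreorder O hiding (Grundy; IsLadder)
  open Window O W? D
  open Grundy g

  private
    Under : Rel ℕ 0ℓ
    Under = Window.Over (dual O) W? D

    Under? : Decidable Under
    Under? = Window.Over? (dual O) W? D

  -- The witness v of x in `D l` lies outside the convex W, so it does not separate `cut l`: the
  -- whole cut is on one side of v. As x is comparable to each element of the cut but not to v, the
  -- whole cut is on that same side of x.
  untouched⇒Over⊎Under : ∀ {j l x} → j ∈ J → l ∈ J → l < j → Meets l → x ∈ cut j →
                         (∀ {y} → y ∈ cut l → ¬ x ∥ y) → Over j l ⊎ Under j l
  untouched⇒Over⊎Under {j} {l} {x} j∈ l∈ l<j m x∈ untouched = side (chain l∈ (proj₁ q∈D) v∈)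
    where
    wit : ∃[ z ] z ∈ D l × x ∥ z
    wit = witness j∈ l∈ l<j (proj₁ (∈-filter⁻ W? {xs = D j} x∈))
    v : A
    v = proj₁ wit
    v∈ : v ∈ D l
    v∈ = proj₁ (proj₂ wit)
    x∥v : x ∥ v
    x∥v = proj₂ (proj₂ wit)
    v∉W : ¬ W v
    v∉W wv = untouched (∈-filter⁺ W? v∈ wv) x∥v
    q : A
    q = proj₁ (meets-cut m)
    q∈D : q ∈ D l × W q
    q∈D = ∈-filter⁻ W? (proj₂ (meets-cut m))
    below : q ≼ v → ∀ {r} → r ∈ cut l → r ≺ x
    below q≼v {r} r∈ with ∈-filter⁻ W? {xs = D l} r∈
    ... | r∈D , wr with chain l∈ r∈D v∈ | ¬∥⇒comparable (untouched r∈)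
    ... | inj₂ v≼r | _         = contradiction (convex q≼v v≼r (proj₂ q∈D) wr) v∉W
    ... | inj₁ r≼v | inj₁ x≼r  = contradiction (≼-trans x≼r r≼v) (proj₁ x∥v)
    ... | inj₁ r≼v | inj₂ r≼x  = r≼x , λ x≼r → proj₁ x∥v (≼-trans x≼r r≼v)
    above : v ≼ q → ∀ {r} → r ∈ cut l → x ≺ r
    above v≼q {r} r∈ with ∈-filter⁻ W? {xs = D l} r∈
    ... | r∈D , wr with chain l∈ r∈D v∈ | ¬∥⇒comparable (untouched r∈)
    ... | inj₁ r≼v | _         = contradiction (convex r≼v v≼q wr (proj₂ q∈D)) v∉W
    ... | inj₂ v≼r | inj₂ r≼x  = contradiction (≼-trans v≼r r≼x) (proj₂ x∥v)
    ... | inj₂ v≼r | inj₁ x≼r  = x≼r , λ r≼x → proj₂ x∥v (≼-trans v≼r r≼x)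
    side : q ≼ v ⊎ v ≼ q → Over j l ⊎ Under j l
    side (inj₁ q≼v) = inj₁ (l<j , lose x∈ (All.tabulate (below q≼v)))
    side (inj₂ v≼q) = inj₂ (l<j , lose x∈ (All.tabulate (above v≼q)))

  -- Two applications of Mirsky's theorem select colours that are pairwise unrelated by `Over` and
  -- then by `Under`. Each costs a factor μ * w + 1, and among the selected colours every witness
  -- can be taken in W.
  grundy-cut : ∀ {S w μ} → (∀ {j x} → j ∈ J → x ∈ D j → S x) → Width S w → LadderFree S (suc μ) →
               ∀ c → suc (μ * w) * (suc (μ * w) * c) < length (filter Meets? J) →
               ∃[ J′ ] c < length J′ × Grundy O J′ cut × (∀ {j} → j ∈ J′ → j ∈ J)
  grundy-cut {S} {w} {μ} inS width free c lt
    with mirsky Over? (suc (μ * w)) (suc (μ * w) * c) (filter Meets? J) (AllPairsₚ.filter⁺ Meets? decreasing) lt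
  ... | inj₁ ch = contradiction ch (no-long-Over-chain O W? convex g inS width free)
  ... | inj₂ (mkAntichain J₁ ¬over J₁⊆ dec₁ lt₁)
    with mirsky Under? (suc (μ * w)) c J₁ dec₁ lt₁
  ... | inj₁ (mkChain js ls ms len) =
    contradiction (mkChain js ls (All.map J₁⊆ ms) len)
      (no-long-Over-chain (dual O) W? (λ a b c d → convex b a d c) (Grundy-dual O g) inS
        (Width-dual O width) (LadderFree-dual O free))
  ... | inj₂ (mkAntichain J₂ ¬under J₂⊆ dec₂ lt₂) =
    J₂ , lt₂ , record { decreasing = dec₂ ; chain = chain′ ; inhabited = λ j∈ → meets-cut (proj₂ (in-J j∈)) ; witness = witness′ } ,
    (proj₁ ∘ in-J)
    where
    in-J : ∀ {j} → j ∈ J₂ → j ∈ J × Meets j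
    in-J j∈ = ∈-filter⁻ Meets? (J₁⊆ (J₂⊆ j∈))
    chain′ : ∀ {j x y} → j ∈ J₂ → x ∈ cut j → y ∈ cut j → x ≼ y ⊎ y ≼ x
    chain′ {j} j∈ x∈ y∈ = chain (proj₁ (in-J j∈)) (proj₁ (∈-filter⁻ W? {xs = D j} x∈)) (proj₁ (∈-filter⁻ W? {xs = D j} y∈))
    witness′ : ∀ {j l x} → j ∈ J₂ → l ∈ J₂ → l < j → x ∈ cut j → ∃[ y ] y ∈ cut l × x ∥ y
    witness′ {j} {l} {x} j∈ l∈ l<j x∈ with any? (x ∥?_) (cut l)
    ... | yes t = find t
    ... | no ¬t with untouched⇒Over⊎Under (proj₁ (in-J j∈)) (proj₁ (in-J l∈)) l<j (proj₂ (in-J l∈)) x∈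
                       (λ y∈ x∥y → ¬t (lose y∈ x∥y))
    ... | inj₁ o = contradiction o (¬over (J₂⊆ j∈) (J₂⊆ l∈))
    ... | inj₂ u = contradiction u (¬under j∈ l∈)

-- Doubling the width for ladder-free families.

AllPairs-take-drop : ∀ {A : Set} {R : Rel A 0ℓ} n {xs x y} → AllPairs R xs → x ∈ take n xs → y ∈ drop n xs → R x y
AllPairs-take-drop (suc n) {_ ∷ xs} (r ∷ _)  (here refl) y∈ = All.lookup (Allₚ.drop⁺ n r) y∈
AllPairs-take-drop (suc n) {_ ∷ xs} (_ ∷ rs) (there x∈)  y∈ = AllPairs-take-drop n rs x∈ y∈

∈-take : ∀ {A : Set} n {xs : List A} {x} → x ∈ take n xs → x ∈ xs
∈-take (suc n) {_ ∷ xs} (here eq)  = here eq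
∈-take (suc n) {_ ∷ xs} (there x∈) = there (∈-take n x∈)

∈-drop : ∀ {A : Set} n {xs : List A} {x} → x ∈ drop n xs → x ∈ xs
∈-drop zero             x∈ = x∈
∈-drop (suc n) {_ ∷ xs} x∈ = there (∈-drop n x∈)

split-list : ∀ {A : Set} n {m} (xs : List A) → length xs ≡ n + suc m →
             ∃[ as ] ∃[ y ] ∃[ bs ] xs ≡ as ++ y ∷ bs × length as ≡ n × length bs ≡ m
split-list zero    (x ∷ xs) eq = [] , x , xs , refl , refl , suc-injective eq
split-list (suc n) (x ∷ xs) eq with split-list n xs (suc-injective eq)
... | as , y , bs , refl , eqa , eqb = x ∷ as , y , bs , refl , cong suc eqa , eqb

AllPairs-++⁻ : ∀ {A : Set} {R : Rel A 0ℓ} as {y bs} → AllPairs R (as ++ y ∷ bs) →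
               AllPairs R as × All (λ a → R a y) as × AllPairs R (y ∷ bs)
AllPairs-++⁻ []       ps       = [] , [] , ps
AllPairs-++⁻ (a ∷ as) (p ∷ ps) with AllPairs-++⁻ as ps
... | qs , rs , ss = Allₚ.++⁻ˡ as p ∷ qs , All.head (Allₚ.++⁻ʳ as p) ∷ rs , ss

choices : ∀ {A B : Set} {Q : A → B → Set} {xs} → All (λ x → ∃[ y ] Q x y) xs →
          ∃[ ps ] map proj₁ ps ≡ xs × All (λ p → Q (proj₁ p) (proj₂ p)) ps
choices []             = [] , refl , []
choices ((y , q) ∷ qs) with choices qs
... | ps , eq , all = (_ , y) ∷ ps , cong (_ ∷_) eq , q ∷ all

AllPairs->⇒Unique : ∀ {js} → AllPairs _>_ js → Unique js
AllPairs->⇒Unique = AllPairs.map λ i>j i≡j → <-irrefl (sym i≡j) i>j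

Elem : ∀ {A : Set} → List ℕ → (ℕ → List A) → Pred A 0ℓ
Elem J D x = ∃[ j ] j ∈ J × x ∈ D j

-- The width is measured on the classes alone, while S carries the excluded ladders. This lets a
-- bound for a smaller width be applied to the cut families.
GrundyBound : ∀ {A} → DecPreorder A → Pred A 0ℓ → ℕ → ℕ → Set
GrundyBound O S w b =
  ∀ {J D} → Grundy O J D → (∀ {j x} → j ∈ J → x ∈ D j → S x) → DecPreorder.Width O (Elem J D) w → length J ≤ b

module Doubling {A : Set} (O : DecPreorder A) (S : Pred A 0ℓ) (μ : ℕ) (free : DecPreorder.LadderFree O S (suc μ))
                (h Φ : ℕ) (bound : GrundyBound O S h Φ) where
  open DecPreorder O hiding (Grundy; IsLadder)

  -- κ is the threshold of `grundy-cut` for c = Φ. A chain of chainLength + 1 = 2κ + 5 elements has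
  -- room for v₀, κ + 1 elements, vₘ, κ + 1 elements and vₑ. `cost` adds to the N colours spent on
  -- finding it the κ colours lost on either side. Two incomparable antichains of h + 1 elements
  -- exceed w = 2h + 1.
  w a κ chainLength N cost : ℕ
  w = suc (h + h)
  a = suc (μ * w)
  κ = a * (a * Φ)
  chainLength = suc (κ + suc (suc κ + 1))
  N = suc (chainLength * w)
  cost = N + (κ + κ)

  module _ {J : List ℕ} {D : ℕ → List A} (g : Grundy O J D)
           (inS : ∀ {j x} → j ∈ J → x ∈ D j → S x) (width : Width (Elem J D) w) where
    open Grundy g

    free′ : LadderFree (Elem J D) (suc μ)
    free′ rs ss = free rs (All.map (λ ((i , i∈ , l∈) , (j , j∈ , h∈)) → inS i∈ l∈ , inS j∈ h∈) ss)

    colours : ∀ {W : Pred A 0ℓ} → Decidable₁ W → List ℕ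
    colours W? = filter (Window.Meets? O W? D) J

    -- Both windows would contain Grundy families of more than Φ colours, hence
    -- antichains of more than h elements, whose union is an antichain.
    incomparable-windows : ∀ {V W : Pred A 0ℓ} (V? : Decidable₁ V) (W? : Decidable₁ W) → Convex V → Convex W →
                           (∀ {x y} → V x → W y → x ∥ y) → κ < length (colours V?) → κ < length (colours W?) → ⊥
    incomparable-windows V? W? cV cW V∥W ltV ltW
      with grundy-cut O V? cV g (λ j∈ x∈ → _ , j∈ , x∈) width free′ Φ ltV
         | grundy-cut O W? cW g (λ j∈ x∈ → _ , j∈ , x∈) width free′ Φ ltW
    ... | J₁ , lt₁ , g₁ , J₁⊆ | J₂ , lt₂ , g₂ , J₂⊆ =
      <⇒≱ lt₁ (bound g₁ (λ {j} j∈ x∈ → inS (J₁⊆ j∈) (proj₁ (∈-filter⁻ V? {xs = D j} x∈))) width₁)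
      where
      width₁ : Width (Elem J₁ (Window.cut O V? D)) h
      width₁ ys yV ys∥ with length ys ≤? h
      ... | yes le = le
      ... | no ¬le = ⊥-elim (<⇒≱ lt₂ (bound g₂ (λ {j} j∈ x∈ → inS (J₂⊆ j∈) (proj₁ (∈-filter⁻ W? {xs = D j} x∈))) width₂))
        where
        width₂ : Width (Elem J₂ (Window.cut O W? D)) h
        width₂ zs zW zs∥ = +-cancelˡ-≤ (suc h) _ _ (≤-trans (+-monoˡ-≤ (length zs) (≰⇒> ¬le))
          (≤-trans (≤-reflexive (sym (length-++ ys)))
            (width (ys ++ zs)
              (Allₚ.++⁺ (All.map (λ (j , j∈ , x∈) → j , J₁⊆ j∈ , proj₁ (∈-filter⁻ V? x∈)) yV)
                        (All.map (λ (j , j∈ , x∈) → j , J₂⊆ j∈ , proj₁ (∈-filter⁻ W? x∈)) zW))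
              (AllPairsₚ.++⁺ ys∥ zs∥ (All.map (λ (i , _ , x∈) → All.map (λ (j , _ , y∈) →
                V∥W (proj₂ (∈-filter⁻ V? {xs = D i} x∈)) (proj₂ (∈-filter⁻ W? {xs = D j} y∈))) zW) yV)))))

    Between : A → A → Pred A 0ℓ
    Between y z u = y ≺ u × u ≺ z

    Between? : ∀ y z → Decidable₁ (Between y z)
    Between? y z u = (y ≺? u) ×-dec (u ≺? z)

    Between-convex : ∀ y z → Convex (Between y z)
    Between-convex y z p q ((a , b) , _) (_ , (c , d)) =
      (≼-trans a p , λ r → b (≼-trans p r)) , (≼-trans q c , λ r → d (≼-trans r q))

    Beside : A → A → Pred A 0ℓ
    Beside y z u = u ∥ y × u ∥ z

    Beside? : ∀ y z → Decidable₁ (Beside y z)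
    Beside? y z u = (u ∥? y) ×-dec (u ∥? z)

    Beside-convex : ∀ y z → Convex (Beside y z)
    Beside-convex y z p q ((a , _) , (c , _)) ((_ , b) , (_ , d)) =
      ((λ r → a (≼-trans p r)) , λ r → b (≼-trans r q)) , ((λ r → c (≼-trans p r)) , λ r → d (≼-trans r q))

    Beside∥Between : ∀ {y z u v} → Beside y z u → Between y z v → u ∥ v
    Beside∥Between ((_ , a) , (b , _)) ((c , _) , (d , _)) = (λ r → b (≼-trans r d)) , λ r → a (≼-trans c r)

    few-beside : ∀ {y z} → κ < length (colours (Between? y z)) → length (colours (Beside? y z)) ≤ κ
    few-beside {y} {z} lt = ≮⇒≥ λ lt′ →
      incomparable-windows (Beside? y z) (Between? y z) (Beside-convex y z) (Between-convex y z) Beside∥Between lt′ lt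

    -- If x and y were equivalent, the witness of x in `D l`, being comparable to y, would be
    -- comparable to x. Thus for elements of different classes the absence of `≺` both ways means
    -- incomparability.
    distinct-colours : ∀ {j l x y} → j ∈ J → l ∈ J → l < j → x ∈ D j → y ∈ D l → x ≼ y → ¬ y ≼ x
    distinct-colours j∈ l∈ l<j x∈ y∈ x≼y y≼x with witness j∈ l∈ l<j x∈
    ... | z , z∈ , x≰z , z≰x with chain l∈ y∈ z∈
    ... | inj₁ y≼z = x≰z (≼-trans x≼y y≼z)
    ... | inj₂ z≼y = z≰x (≼-trans z≼y y≼x)

    -- X is the antichain built so far, and Γ holds the colours that can still extend it: each has
    -- an element incomparable to all of X.
    record State (X : List A) (Γ : List ℕ) : Set where
      field
        X-elem     : All (Elem J D) X
        antichain  : AllPairs _∥_ X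
        Γ-pairs    : AllPairs _>_ Γ
        Γ⊆J        : ∀ {l} → l ∈ Γ → l ∈ J
        beside     : ∀ {l} → l ∈ Γ → ∃[ v ] v ∈ D l × All (v ∥_) X

    -- On a long chain v₀ < ⋯ < vₘ < ⋯ < vₑ of witnesses, few colours have an element
    -- beside both v₀ and vₘ or both vₘ and vₑ.  Every other low colour has its witness
    -- against vₘ strictly between v₀ and vₑ, hence incomparable to X.
    extend : ∀ {X Γ} → State X Γ → N ≤ length Γ →
             ∃[ x ] ∃[ Γ′ ] State (x ∷ X) Γ′ × length Γ ≤ cost + length Γ′
    extend {X} {Γ} st N≤ with choices (All.tabulate {xs = take N Γ} (λ l∈ → State.beside st (∈-take N l∈)))
    ... | ps , ps-colours , ps-beside
      -- N = chainLength * w + 1 witnesses, taken from the highest colours of Γ. More than w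
      -- pairwise incomparable ones would violate the width, so a chain of chainLength + 1 remains.
      with mirsky (λ p q → proj₂ p ≺? proj₂ q) chainLength w ps
             (AllPairsₚ.map⁻ (subst (AllPairs _>_) (sym ps-colours) (AllPairsₚ.take⁺ N (State.Γ-pairs st))))
             (≤-reflexive (trans (sym (m≤n⇒m⊓n≡m N≤)) (trans (sym (length-take N Γ))
                (trans (cong length (sym ps-colours)) (length-map proj₁ ps)))))
    ... | inj₂ (mkAntichain as indep as⊆ pairs lt) =
      contradiction (width (map proj₂ as)
          (Allₚ.map⁺ (All.tabulate λ p∈ → _ , colour∈J (as⊆ p∈) , proj₁ (All.lookup ps-beside (as⊆ p∈))))
          (AllPairsₚ.map⁺ (AllPairs-build incomparable pairs)))
        (<⇒≱ (subst (w <_) (sym (length-map proj₂ as)) lt))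
      where
      open State st
      colour∈J : ∀ {p} → p ∈ ps → proj₁ p ∈ J
      colour∈J p∈ = Γ⊆J (∈-take N (subst (_ ∈_) ps-colours (∈-map⁺ proj₁ p∈)))
      incomparable : ∀ {p q} → p ∈ as → q ∈ as → proj₁ p > proj₁ q → proj₂ p ∥ proj₂ q
      incomparable p∈ q∈ gt = (λ p≼q → indep p∈ q∈ (p≼q , distinct p≼q)) , λ q≼p → indep q∈ p∈ (q≼p , λ p≼q → distinct p≼q q≼p)
        where
        distinct = distinct-colours (colour∈J (as⊆ p∈)) (colour∈J (as⊆ q∈)) gt
                     (proj₁ (All.lookup ps-beside (as⊆ p∈))) (proj₁ (All.lookup ps-beside (as⊆ q∈)))
    ... | inj₁ (mkChain (p₀ ∷ cs) links (p₀∈ ∷ cs⊆) len)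
      with split-list (suc κ) cs (trans (suc-injective len) (cong suc refl))
    ... | as , pₘ , cs′ , refl , len-as , len-cs′
      with split-list (suc κ) {0} cs′ len-cs′
    ... | bs , pₑ , [] , refl , len-bs , refl =
      vₘ , Γ₂ , record
        { X-elem    = (_ , colour∈J pₘ∈ , vₘ∈) ∷ X-elem
        ; antichain = vₘ∥X ∷ antichain
        ; Γ-pairs   = AllPairsₚ.filter⁺ ¬right (AllPairsₚ.filter⁺ ¬left (AllPairsₚ.drop⁺ N Γ-pairs))
        ; Γ⊆J       = Γ₁⊆J ∘ Γ₂⊆
        ; beside    = beside′
        } , count
      where
      open State st
      colour∈Γ : ∀ {p} → p ∈ ps → proj₁ p ∈ take N Γ
      colour∈Γ p∈ = subst (_ ∈_) ps-colours (∈-map⁺ proj₁ p∈)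
      colour∈J : ∀ {p} → p ∈ ps → proj₁ p ∈ J
      colour∈J p∈ = Γ⊆J (∈-take N (colour∈Γ p∈))
      value∈ : ∀ {p} → p ∈ ps → proj₂ p ∈ D (proj₁ p)
      value∈ p∈ = proj₁ (All.lookup ps-beside p∈)
      v₀ vₘ vₑ : A
      v₀ = proj₂ p₀
      vₘ = proj₂ pₘ
      vₑ = proj₂ pₑ
      as⊆ : All (_∈ ps) as
      as⊆ = Allₚ.++⁻ˡ as cs⊆
      cs′⊆ : All (_∈ ps) (pₘ ∷ bs ++ pₑ ∷ [])
      cs′⊆ = Allₚ.++⁻ʳ as cs⊆
      pₘ∈ : pₘ ∈ ps
      pₘ∈ = All.head cs′⊆
      bs⊆ : All (_∈ ps) bs
      bs⊆ = Allₚ.++⁻ˡ bs (All.tail cs′⊆)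
      pₑ∈ : pₑ ∈ ps
      pₑ∈ = All.head (Allₚ.++⁻ʳ bs (All.tail cs′⊆))
      vₘ∈ : vₘ ∈ D (proj₁ pₘ)
      vₘ∈ = value∈ pₘ∈
      sorted : AllPairs (λ p q → proj₂ p ≺ proj₂ q) (p₀ ∷ as ++ pₘ ∷ bs ++ pₑ ∷ [])
      sorted = Linked⇒AllPairs (λ p q → ≺-trans p q) links
      left-part = AllPairs-++⁻ as (AllPairs.tail sorted)
      right-part = AllPairs-++⁻ bs (AllPairs.tail (proj₂ (proj₂ left-part)))
      v₀≺vₘ : v₀ ≺ vₘ
      v₀≺vₘ = All.head (Allₚ.++⁻ʳ as (AllPairs.head sorted))
      vₘ≺rest : All (λ p → vₘ ≺ proj₂ p) (bs ++ pₑ ∷ [])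
      vₘ≺rest = AllPairs.head (proj₂ (proj₂ left-part))
      vₘ≺vₑ : vₘ ≺ vₑ
      vₘ≺vₑ = All.head (Allₚ.++⁻ʳ bs vₘ≺rest)
      v∥X : ∀ {p} → p ∈ ps → All (proj₂ p ∥_) X
      v∥X p∈ = proj₂ (All.lookup ps-beside p∈)
      vₘ∥X : All (vₘ ∥_) X
      vₘ∥X = v∥X pₘ∈
      -- Distinct members of `ps` carry distinct colours, so κ + 1 of them between y and z make that
      -- window meet more than κ colours, as `few-beside` requires.
      crowded : ∀ {y z} qs → length qs ≡ suc κ → All (_∈ ps) qs → AllPairs (λ p q → proj₂ p ≺ proj₂ q) qs →
                All (λ p → Between y z (proj₂ p)) qs → κ < length (colours (Between? y z))
      crowded {y} {z} qs len-qs qs⊆ qs-sorted qs-between =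
        ≤-trans (≤-reflexive (trans (sym len-qs) (sym (length-map proj₁ qs))))
          (Unique-length-≤ (AllPairsₚ.map⁺ (AllPairs-build different qs-sorted)) λ l∈ →
            let p , p∈ , eq = ∈-map⁻ proj₁ l∈ in
            subst (_∈ colours (Between? y z)) (sym eq)
              (∈-filter⁺ (Window.Meets? O (Between? y z) D) (colour∈J (All.lookup qs⊆ p∈))
                (lose (value∈ (All.lookup qs⊆ p∈)) (All.lookup qs-between p∈))))
        where
        different : ∀ {p q} → p ∈ qs → q ∈ qs → proj₂ p ≺ proj₂ q → proj₁ p ≢ proj₁ q
        different p∈ q∈ p≺q eq
          with AllPairs-lookup (AllPairsₚ.map⁻ {f = proj₁} (subst (AllPairs _>_) (sym ps-colours) (AllPairsₚ.take⁺ N Γ-pairs)))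
                 (All.lookup qs⊆ p∈) (All.lookup qs⊆ q∈)
        ... | inj₁ refl      = proj₂ p≺q (proj₁ p≺q)
        ... | inj₂ (inj₁ gt) = <-irrefl (sym eq) gt
        ... | inj₂ (inj₂ gt) = <-irrefl eq gt
      few-left : length (colours (Beside? v₀ vₘ)) ≤ κ
      few-left = few-beside (crowded as len-as as⊆ (proj₁ left-part)
        (All.zip (Allₚ.++⁻ˡ as (AllPairs.head sorted) , proj₁ (proj₂ left-part))))
      few-right : length (colours (Beside? vₘ vₑ)) ≤ κ
      few-right = few-beside (crowded bs len-bs bs⊆ (proj₁ right-part)
        (All.zip (Allₚ.++⁻ˡ bs vₘ≺rest , proj₁ (proj₂ right-part))))
      left = Window.Meets? O (Beside? v₀ vₘ) D
      right = Window.Meets? O (Beside? vₘ vₑ) D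
      ¬left = ¬? ∘ left
      ¬right = ¬? ∘ right
      Γ₀ Γ₁ Γ₂ : List ℕ
      Γ₀ = drop N Γ
      Γ₁ = filter ¬left Γ₀
      Γ₂ = filter ¬right Γ₁
      Γ₁⊆J : ∀ {l} → l ∈ Γ₁ → l ∈ J
      Γ₁⊆J l∈ = Γ⊆J (∈-drop N (proj₁ (∈-filter⁻ ¬left l∈)))
      Γ₂⊆ : ∀ {l} → l ∈ Γ₂ → l ∈ Γ₁
      Γ₂⊆ l∈ = proj₁ (∈-filter⁻ ¬right l∈)
      few : ∀ {P : Pred ℕ 0ℓ} (P? : Decidable₁ P) {Δ} → AllPairs _>_ Δ → (∀ {l} → l ∈ Δ → l ∈ J) →
            length (filter P? J) ≤ κ → length Δ ≤ κ + length (filter (¬? ∘ P?) Δ)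
      few P? {Δ} Δ-pairs Δ⊆ le = ≤-trans (≤-reflexive (length-filter-¬ P? Δ)) (+-monoˡ-≤ _
        (≤-trans (Unique-length-≤ (AllPairs->⇒Unique (AllPairsₚ.filter⁺ P? Δ-pairs))
           (λ l∈ → let a , b = ∈-filter⁻ P? l∈ in ∈-filter⁺ P? (Δ⊆ a) b)) le))
      count : length Γ ≤ cost + length Γ₂
      count = begin
        length Γ                          ≡⟨ sym (m+[n∸m]≡n N≤) ⟩
        N + (length Γ ∸ N)                ≡⟨ cong (N +_) (sym (length-drop N Γ)) ⟩
        N + length Γ₀                     ≤⟨ +-monoʳ-≤ N (few left (AllPairsₚ.drop⁺ N Γ-pairs) (Γ⊆J ∘ ∈-drop N) few-left) ⟩
        N + (κ + length Γ₁)               ≤⟨ +-monoʳ-≤ N (+-monoʳ-≤ κ (few right (AllPairsₚ.filter⁺ ¬left (AllPairsₚ.drop⁺ N Γ-pairs)) Γ₁⊆J few-right)) ⟩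
        N + (κ + (κ + length Γ₂))         ≡⟨ cong (N +_) (sym (+-assoc κ κ _)) ⟩
        N + ((κ + κ) + length Γ₂)         ≡⟨ sym (+-assoc N (κ + κ) _) ⟩
        cost + length Γ₂                  ∎
        where open ≤-Reasoning
      beside′ : ∀ {l} → l ∈ Γ₂ → ∃[ v ] v ∈ D l × All (v ∥_) (vₘ ∷ X)
      beside′ {l} l∈ = u , u∈ , ∥-sym vₘ∥u ∷ All.zipWith (λ (p , q) → squeeze p q) (v∥X p₀∈ , v∥X pₑ∈)
        where
        l∈Γ₀ : l ∈ Γ₀
        l∈Γ₀ = proj₁ (∈-filter⁻ ¬left (Γ₂⊆ l∈))
        wit : ∃[ u ] u ∈ D l × vₘ ∥ u
        -- The colour of vₘ is among the first N of the decreasing list Γ and l is among the rest,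
        -- so l is the smaller colour.
        wit = witness (colour∈J pₘ∈) (Γ₁⊆J (Γ₂⊆ l∈)) (AllPairs-take-drop N Γ-pairs (colour∈Γ pₘ∈) l∈Γ₀) vₘ∈
        u : A
        u = proj₁ wit
        u∈ : u ∈ D l
        u∈ = proj₁ (proj₂ wit)
        vₘ∥u : vₘ ∥ u
        vₘ∥u = proj₂ (proj₂ wit)
        v₀≼u : v₀ ≼ u
        v₀≼u with ¬∥⇒comparable (λ u∥v₀ → proj₂ (∈-filter⁻ ¬left {xs = Γ₀} (Γ₂⊆ l∈)) (lose u∈ (u∥v₀ , ∥-sym vₘ∥u)))
        ... | inj₁ u≼v₀ = contradiction (≼-trans u≼v₀ (proj₁ v₀≺vₘ)) (proj₂ vₘ∥u)
        ... | inj₂ v₀≼u = v₀≼u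
        u≼vₑ : u ≼ vₑ
        u≼vₑ with ¬∥⇒comparable (λ u∥vₑ → proj₂ (∈-filter⁻ ¬right {xs = Γ₁} l∈) (lose u∈ (∥-sym vₘ∥u , u∥vₑ)))
        ... | inj₁ u≼vₑ = u≼vₑ
        ... | inj₂ vₑ≼u = contradiction (≼-trans (proj₁ vₘ≺vₑ) vₑ≼u) (proj₁ vₘ∥u)
        -- An element of X comparable to u would be comparable to v₀ or to vₑ.
        squeeze : ∀ {x} → v₀ ∥ x → vₑ ∥ x → u ∥ x
        squeeze (a , _) (_ , b) = (λ r → a (≼-trans v₀≼u r)) , λ r → b (≼-trans r u≼vₑ)

    -- r bounds the number of elements that X can still gain before it exceeds the width. Each gain
    -- loses at most `cost` colours, and with fewer than N colours left the bound holds at once.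
    state-bound : ∀ r {X Γ} → State X Γ → w < length X + r → length Γ ≤ r * cost
    state-bound zero {X} st lt =
      contradiction (width X (State.X-elem st) (State.antichain st)) (<⇒≱ (subst (w <_) (+-identityʳ _) lt))
    state-bound (suc r) {X} {Γ} st lt with N ≤? length Γ
    ... | no ¬le = ≤-trans (<⇒≤ (≰⇒> ¬le)) (≤-trans (m≤m+n N (κ + κ)) (m≤m+n cost (r * cost)))
    ... | yes le with extend st le
    ... | x , Γ′ , st′ , le′ = ≤-trans le′ (+-monoʳ-≤ cost (state-bound r st′ (subst (w <_) (+-suc _ _) lt)))

    doubled : length J ≤ suc w * cost
    doubled = state-bound (suc w)
      record { X-elem = [] ; antichain = [] ; Γ-pairs = decreasing ; Γ⊆J = id
             ; beside = λ l∈ → let v , v∈ = inhabited l∈ in v , v∈ , [] }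
      ≤-refl

-- Iterated doubling and its numerical bound.

ω : ℕ → ℕ
ω zero    = zero
ω (suc L) = suc (ω L + ω L)

1+ω≡2^ : ∀ L → suc (ω L) ≡ 2 ^ L
1+ω≡2^ zero    = refl
1+ω≡2^ (suc L) = trans (cong suc (sym (+-suc (ω L) (ω L))))
  (trans (cong₂ _+_ (1+ω≡2^ L) (1+ω≡2^ L)) (cong (2 ^ L +_) (sym (+-identityʳ _))))

1+n≤2^n : ∀ n → suc n ≤ 2 ^ n
1+n≤2^n zero    = ≤-refl
1+n≤2^n (suc n) = +-mono-≤ (m^n>0 2 n) (≤-trans (1+n≤2^n n) (m≤m+n _ 0))

-- `Doubling.cost` as a function of w, μ and Φ.
ladderCost : ℕ → ℕ → ℕ → ℕ
ladderCost w μ Φ = suc (suc (κ + suc (suc κ + 1)) * w) + (κ + κ)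
  where κ = suc (μ * w) * (suc (μ * w) * Φ)

-- `ω` iterates the doubling h ↦ 2h + 1, so L rounds cover the widths up to 2 ^ L - 1.
ladderBound : ℕ → ℕ → ℕ
ladderBound μ zero    = 0
ladderBound μ (suc L) = suc (ω (suc L)) * ladderCost (ω (suc L)) μ (ladderBound μ L)

module _ {A : Set} (O : DecPreorder A) {S : Pred A 0ℓ} where
  ladder-free-bound : ∀ μ → DecPreorder.LadderFree O S (suc μ) → ∀ L → GrundyBound O S (ω L) (ladderBound μ L)
  ladder-free-bound μ free zero {[]}    g inS width = z≤n
  ladder-free-bound μ free zero {j ∷ J} g inS width =
    contradiction (width (x ∷ []) ((j , here refl , x∈) ∷ []) ([] ∷ [])) λ ()
    where
    x = proj₁ (Grundy.inhabited g (here refl))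
    x∈ = proj₂ (Grundy.inhabited g (here refl))
  ladder-free-bound μ free (suc L) g inS width =
    Doubling.doubled O S μ free (ω L) (ladderBound μ L) (ladder-free-bound μ free L) g inS width

-- Stated between successors, so that the rounds compose by multiplication.
ladderBound-step : ∀ w μ Φ → suc (suc w * ladderCost w μ Φ) ≤
                   8 * ((suc (μ * w) * suc (μ * w)) * (suc w * suc w)) * suc Φ
ladderBound-step w μ Φ = begin
  suc (V * ladderCost w μ Φ)                ≤⟨ s≤s (*-monoʳ-≤ V cost≤) ⟩
  suc (V * (4 * R * V))                     ≤⟨ +-monoˡ-≤ (V * (4 * R * V)) 1≤ ⟩
  V * (4 * R * V) + V * (4 * R * V)         ≡⟨ collect a V Φ ⟩
  8 * ((a * a) * (V * V)) * suc Φ           ∎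
  where
  open ≤-Reasoning
  a = suc (μ * w)
  V = suc w
  κ = a * (a * Φ)
  R = a * (a * suc Φ)
  collect : ∀ a V Φ → V * (4 * (a * (a * suc Φ)) * V) + V * (4 * (a * (a * suc Φ)) * V) ≡ 8 * ((a * a) * (V * V)) * suc Φ
  collect = solve-∀
  κ<R : suc κ ≤ R
  κ<R = begin
    suc (a * (a * Φ))       ≤⟨ +-monoˡ-≤ (a * (a * Φ)) (s≤s (z≤n {μ * w + μ * w * a})) ⟩
    a * a + a * (a * Φ)     ≡⟨ expand a Φ ⟩
    a * (a * suc Φ)         ∎
    where
    expand : ∀ a Φ → a * a + a * (a * Φ) ≡ a * (a * suc Φ)
    expand = solve-∀
  cost≤ : ladderCost w μ Φ ≤ 4 * R * V
  cost≤ = begin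
    suc (suc (κ + suc (suc κ + 1)) * w) + (κ + κ)            ≤⟨ m≤m+n _ (3 + (κ + κ) + 2 * κ * w) ⟩
    suc (suc (κ + suc (suc κ + 1)) * w) + (κ + κ) + (3 + (κ + κ) + 2 * κ * w) ≡⟨ refactor κ w ⟩
    4 * suc κ * V                                            ≤⟨ *-monoˡ-≤ V (*-monoʳ-≤ 4 κ<R) ⟩
    4 * R * V                                                ∎
    where
    refactor : ∀ κ w → suc (suc (κ + suc (suc κ + 1)) * w) + (κ + κ) + (3 + (κ + κ) + 2 * κ * w) ≡ 4 * suc κ * suc w
    refactor = solve-∀
  1≤ : 1 ≤ V * (4 * R * V)
  1≤ = *-mono-≤ {1} {V} (s≤s z≤n) (*-mono-≤ {1} {4 * R} (*-mono-≤ {1} {4} (s≤s z≤n) (≤-trans (s≤s z≤n) κ<R)) (s≤s z≤n))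

-- With w + 1 = 2 ^ (L + 1) and a ≤ 2 ^ (μ + L + 1), one round multiplies the successor of the bound
-- by at most 2 ^ (3 + 2(μ + L + 1) + 2(L + 1)). The exponent of a round is linear in L, so that of
-- all rounds is quadratic.
ladderBound-≤ : ∀ μ L → suc (ladderBound μ L) ≤ 2 ^ (L * (7 + 2 * μ + 4 * L))
ladderBound-≤ μ zero    = ≤-refl
ladderBound-≤ μ (suc L) = begin
  suc (suc w * ladderCost w μ Φ)                         ≤⟨ ladderBound-step w μ Φ ⟩
  8 * ((a * a) * (suc w * suc w)) * suc Φ                ≤⟨ *-mono-≤ (*-monoʳ-≤ 8 (*-mono-≤ (*-mono-≤ a≤ a≤) (*-mono-≤ V≤ V≤))) (ladderBound-≤ μ L) ⟩
  2 ^ 3 * ((2 ^ (μ + suc L) * 2 ^ (μ + suc L)) * (2 ^ suc L * 2 ^ suc L)) * 2 ^ e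
                                                         ≡⟨ cong (λ t → 2 ^ 3 * t * 2 ^ e) (cong₂ _*_ (sym (^-distribˡ-+-* 2 (μ + suc L) _)) (sym (^-distribˡ-+-* 2 (suc L) _))) ⟩
  2 ^ 3 * (2 ^ x * 2 ^ y) * 2 ^ e                        ≡⟨ cong (λ t → 2 ^ 3 * t * 2 ^ e) (sym (^-distribˡ-+-* 2 x y)) ⟩
  2 ^ 3 * 2 ^ (x + y) * 2 ^ e                            ≡⟨ cong (_* 2 ^ e) (sym (^-distribˡ-+-* 2 3 (x + y))) ⟩
  2 ^ (3 + (x + y)) * 2 ^ e                              ≡⟨ sym (^-distribˡ-+-* 2 (3 + (x + y)) e) ⟩
  2 ^ (3 + (x + y) + e)                                  ≤⟨ ^-monoʳ-≤ 2 (≤-trans (m≤m+n (3 + (x + y) + e) (4 + 4 * L)) (≤-reflexive (exponents μ L))) ⟩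
  2 ^ (suc L * (7 + 2 * μ + 4 * suc L))                  ∎
  where
  open ≤-Reasoning
  w = ω (suc L)
  Φ = ladderBound μ L
  a = suc (μ * w)
  e = L * (7 + 2 * μ + 4 * L)
  x = (μ + suc L) + (μ + suc L)
  y = suc L + suc L
  V≤ : suc w ≤ 2 ^ suc L
  V≤ = ≤-reflexive (1+ω≡2^ (suc L))
  a≤ : a ≤ 2 ^ (μ + suc L)
  a≤ = begin
    suc (μ * w)          ≤⟨ s≤s (m≤m+n (μ * w) (μ + w)) ⟩
    suc (μ * w + (μ + w)) ≡⟨ factor μ w ⟩
    suc μ * suc w        ≤⟨ *-mono-≤ (1+n≤2^n μ) V≤ ⟩
    2 ^ μ * 2 ^ suc L    ≡⟨ sym (^-distribˡ-+-* 2 μ (suc L)) ⟩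
    2 ^ (μ + suc L)      ∎
    where
    factor : ∀ μ w → suc (μ * w + (μ + w)) ≡ suc μ * suc w
    factor = solve-∀
  exponents : ∀ μ L → 3 + (((μ + suc L) + (μ + suc L)) + (suc L + suc L)) + L * (7 + 2 * μ + 4 * L) + (4 + 4 * L) ≡
                      suc L * (7 + 2 * μ + 4 * suc L)
  exponents = solve-∀

-- Gluing the bounds for a down-set and an up-set.

-- An element of the upper part of D j without an incomparable element in the upper part of
-- D l (l < j) lies below all of the latter.  This relation between colours is transitive, so
-- by Mirsky's theorem the colours contain a large subfamily whose upper parts witness each
-- other, or one whose lower parts do.
module _ {A : Set} (O : DecPreorder A) {U : Pred A 0ℓ} (U? : Decidable₁ U)
         (up : ∀ {x y} → DecPreorder._≼_ O x y → U x → U y)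
         {J : List ℕ} {D : ℕ → List A} (g : Grundy O J D) where
  open DecPreorder O hiding (Grundy; IsLadder)
  open Grundy g
  open Window O U? D

  private
    lower : ℕ → List A
    lower = Window.cut O (¬? ∘ U?) D

    Below : Rel ℕ 0ℓ
    Below j l = Window.Over (dual O) U? D j l × Meets l

    Below? : Decidable Below
    Below? j l = Window.Over? (dual O) U? D j l ×-dec Meets? l

    Below-trans : Transitive Below
    Below-trans ((l<j , b) , _) ((r<l , c) , mr) with find b | find c
    ... | y , y∈ , y≺ | z , z∈ , z≺ = (<-trans r<l l<j , lose y∈ (All.map (≺-trans (All.lookup y≺ z∈)) z≺)) , mr

  not-meeting-Grundy : Grundy O (filter (¬? ∘ Meets?) J) lower
  not-meeting-Grundy = record
    { decreasing = AllPairsₚ.filter⁺ (¬? ∘ Meets?) decreasing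
    ; chain      = λ {j} j∈ x∈ y∈ → chain (proj₁ (in-J j∈)) (proj₁ (∈-filter⁻ (¬? ∘ U?) {xs = D j} x∈))
                                                            (proj₁ (∈-filter⁻ (¬? ∘ U?) {xs = D j} y∈))
    ; inhabited  = λ j∈ → let x , x∈ = inhabited (proj₁ (in-J j∈)) in x , lower⁺ j∈ x∈
    ; witness    = λ {j} j∈ l∈ l<j x∈ →
        let y , y∈ , x∥y = witness (proj₁ (in-J j∈)) (proj₁ (in-J l∈)) l<j (proj₁ (∈-filter⁻ (¬? ∘ U?) {xs = D j} x∈))
        in y , lower⁺ l∈ y∈ , x∥y
    }
    where
    in-J : ∀ {j} → j ∈ filter (¬? ∘ Meets?) J → j ∈ J × ¬ Meets j
    in-J = ∈-filter⁻ (¬? ∘ Meets?)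
    lower⁺ : ∀ {j x} → j ∈ filter (¬? ∘ Meets?) J → x ∈ D j → x ∈ lower j
    lower⁺ j∈ x∈ = ∈-filter⁺ (¬? ∘ U?) x∈ λ ux → proj₂ (in-J j∈) (lose x∈ ux)

  antichain-Grundy : ∀ {Js} → AllPairs _>_ Js → (∀ {j} → j ∈ Js → j ∈ J × Meets j) →
                     (∀ {j l} → j ∈ Js → l ∈ Js → ¬ Below j l) → Grundy O Js cut
  antichain-Grundy {Js} dec in-J ¬below = record
    { decreasing = dec
    ; chain      = λ {j} j∈ x∈ y∈ → chain (proj₁ (in-J j∈)) (proj₁ (∈-filter⁻ U? {xs = D j} x∈))
                                                            (proj₁ (∈-filter⁻ U? {xs = D j} y∈))
    ; inhabited  = meets-cut ∘ proj₂ ∘ in-J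
    ; witness    = wit
    }
    where
    wit : ∀ {j l x} → j ∈ Js → l ∈ Js → l < j → x ∈ cut j → ∃[ y ] y ∈ cut l × x ∥ y
    wit {j} {l} {x} j∈ l∈ l<j x∈ with any? (x ∥?_) (cut l)
    ... | yes t = find t
    ... | no ¬t with witness (proj₁ (in-J j∈)) (proj₁ (in-J l∈)) l<j (proj₁ (∈-filter⁻ U? {xs = D j} x∈))
    ... | v , v∈ , x∥v = contradiction ((l<j , lose x∈ (All.tabulate above)) , proj₂ (in-J l∈)) (¬below j∈ l∈)
      where
      above : ∀ {q} → q ∈ cut l → x ≺ q
      above {q} q∈ with ∈-filter⁻ U? {xs = D l} q∈
      ... | q∈D , uq with chain (proj₁ (in-J l∈)) q∈D v∈ | ¬∥⇒comparable (λ x∥q → ¬t (lose q∈ x∥q))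
      ... | inj₁ q≼v | _        = contradiction (lose (∈-filter⁺ U? v∈ (up q≼v uq)) x∥v) ¬t
      ... | inj₂ v≼q | inj₂ q≼x = contradiction (≼-trans v≼q q≼x) (proj₂ x∥v)
      ... | inj₂ v≼q | inj₁ x≼q = x≼q , λ q≼x → proj₂ x∥v (≼-trans v≼q q≼x)

  -- Let y in the upper part of D i lie below the upper part of D l. An x in the lower part of D i
  -- lies below y, so its witness in D l cannot be in U. The head j serves only to show that the
  -- later lower parts are inhabited: the witnesses of its own y lie in them.
  chain-Grundy : ∀ {j js} → AllPairs Below (j ∷ js) → (∀ {i} → i ∈ j ∷ js → i ∈ J) → Grundy O js lower
  chain-Grundy {j} {js} (b ∷ bs) in-J = record
    { decreasing = AllPairs.map (proj₁ ∘ proj₁) bs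
    ; chain      = λ {i} i∈ x∈ y∈ → chain (in-J (there i∈)) (proj₁ (∈-filter⁻ (¬? ∘ U?) {xs = D i} x∈))
                                                            (proj₁ (∈-filter⁻ (¬? ∘ U?) {xs = D i} y∈))
    ; inhabited  = inh
    ; witness    = wit
    }
    where
    inh : ∀ {i} → i ∈ js → ∃[ x ] x ∈ lower i
    inh {i} i∈ with All.lookup b i∈
    ... | (i<j , o) , _ with find o
    ... | y , y∈ , y≺ with witness (in-J (here refl)) (in-J (there i∈)) i<j (proj₁ (∈-filter⁻ U? {xs = D j} y∈))
    ... | v , v∈ , y∥v = v , ∈-filter⁺ (¬? ∘ U?) v∈ λ uv → proj₁ y∥v (proj₁ (All.lookup y≺ (∈-filter⁺ U? v∈ uv)))
    wit : ∀ {i l x} → i ∈ js → l ∈ js → l < i → x ∈ lower i → ∃[ y ] y ∈ lower l × x ∥ y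
    wit {i} {l} {x} i∈ l∈ l<i x∈ with ∈-filter⁻ (¬? ∘ U?) {xs = D i} x∈
    ... | x∈D , ¬ux with witness (in-J (there i∈)) (in-J (there l∈)) l<i x∈D | AllPairs-lookup bs i∈ l∈
    ... | _            | inj₁ refl                  = contradiction l<i (<-irrefl refl)
    ... | _            | inj₂ (inj₂ ((i<l , _) , _)) = contradiction l<i (<-asym i<l)
    ... | v , v∈ , x∥v | inj₂ (inj₁ ((_ , o) , _)) with find o
    ... | y , y∈ , y≺ with ∈-filter⁻ U? {xs = D i} y∈
    ... | y∈D , uy with chain (in-J (there i∈)) x∈D y∈D
    ... | inj₂ y≼x = contradiction (up y≼x uy) ¬ux
    ... | inj₁ x≼y = v , ∈-filter⁺ (¬? ∘ U?) v∈
      (λ uv → proj₁ x∥v (≼-trans x≼y (proj₁ (All.lookup y≺ (∈-filter⁺ U? v∈ uv))))) , x∥v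

  -- The bound is (kl + 1)(kh + 1) - 1: at most (kl + 1) * kh colours meet U, and at most kl do not.
  product-bound : ∀ {kl kh} →
                  (∀ {J′} → Grundy O J′ lower → (∀ {j} → j ∈ J′ → j ∈ J) → length J′ ≤ kl) →
                  (∀ {J′} → Grundy O J′ cut   → (∀ {j} → j ∈ J′ → j ∈ J) → length J′ ≤ kh) →
                  length J ≤ suc kl * kh + kl
  product-bound {kl} {kh} low high =
    ≤-trans (≤-reflexive (length-filter-¬ Meets? J))
      (+-mono-≤ (≮⇒≥ meeting) (low not-meeting-Grundy (proj₁ ∘ ∈-filter⁻ (¬? ∘ Meets?))))
    where
    meeting : ¬ suc kl * kh < length (filter Meets? J)
    meeting lt with mirsky Below? (suc kl) kh (filter Meets? J) (AllPairsₚ.filter⁺ Meets? decreasing) lt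
    -- A chain of kl + 2 colours; without its head, kl + 1 remain, one too many.
    ... | inj₁ (mkChain (j ∷ js) ls ms len) =
      <⇒≱ (≤-reflexive (sym (suc-injective len)))
        (low (chain-Grundy (Linked⇒AllPairs Below-trans ls) in-J) (in-J ∘ there))
      where
      in-J : ∀ {i} → i ∈ j ∷ js → i ∈ J
      in-J i∈ = proj₁ (∈-filter⁻ Meets? {xs = J} (All.lookup ms i∈))
    ... | inj₂ (mkAntichain Js ¬below Js⊆ dec lt′) =
      <⇒≱ lt′ (high (antichain-Grundy dec (∈-filter⁻ Meets? ∘ Js⊆) ¬below) (proj₁ ∘ ∈-filter⁻ Meets? ∘ Js⊆))

-- Posets without a given tower of ladders.

-- Tower ms z: a series composition of ladders lies below z, the sizes being suc m for m
-- in ms, from the topmost ladder down.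
data Tower {A : Set} (O : DecPreorder A) : List ℕ → A → Set where
  base  : ∀ {z} → Tower O [] z
  stage : ∀ {m ms r rs z} → IsLadder O (r ∷ rs) → length rs ≡ m →
          All (λ p → DecPreorder._≺_ O (proj₂ p) z) (r ∷ rs) → Tower O ms (proj₁ r) → Tower O (m ∷ ms) z

towerBound : List ℕ → ℕ → ℕ
towerBound []       L = 0
towerBound (m ∷ ms) L = suc (towerBound ms L) * ladderBound (suc m) L + towerBound ms L

module _ {A : Set} (O : DecPreorder A) where
  open DecPreorder O hiding (Grundy; IsLadder)

  ≺-≼-trans : ∀ {x y z} → x ≺ y → y ≼ z → x ≺ z
  ≺-≼-trans (p , q) r = ≼-trans p r , λ s → q (≼-trans r s)

  Tower-up : ∀ {ms x y} → x ≼ y → Tower O ms x → Tower O ms y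
  Tower-up x≼y base                = base
  Tower-up x≼y (stage lad len b t) = stage lad len (All.map (λ p → ≺-≼-trans p x≼y) b) t

  IsLadder-prefix : ∀ rs {ss} → IsLadder O (rs ++ ss) → IsLadder O rs
  IsLadder-prefix rs lad = record
    { rungs   = Allₚ.++⁻ˡ rs rungs
    ; steps   = prefix rs steps
    ; upwards = λ p∈ q∈ → upwards (∈-++⁺ˡ p∈) (∈-++⁺ˡ q∈)
    }
    where
    open IsLadder lad
    prefix : ∀ {R : Rel (A × A) 0ℓ} rs {ss} → AllPairs R (rs ++ ss) → AllPairs R rs
    prefix []       _        = []
    prefix (r ∷ rs) (p ∷ ps) = Allₚ.++⁻ˡ rs p ∷ prefix rs ps

  -- The last rung of a ladder in S with suc (suc m) rungs caps a tower of type m ∷ ms.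
  capped-ladder : ∀ {m ms} {S : Pred A 0ℓ} → (∀ {z} → S z → ¬ Tower O (m ∷ ms) z) → (∀ {z} → S z → Tower O ms z) →
                  LadderFree S (suc (suc m))
  capped-ladder {m} ¬tower tower rs ss lad len
    with split-list (suc m) {0} rs (trans len (cong suc (sym (+-comm m 1))))
  ... | r ∷ rs′ , y , [] , refl , len′ , refl =
    ¬tower (proj₂ (All.head (Allₚ.++⁻ʳ (r ∷ rs′) ss)))
      (stage (IsLadder-prefix (r ∷ rs′) lad) (suc-injective len′)
        (All.zipWith (λ ((_ , l′≰h , h≼h′) , l≼h) → h≼h′ , λ h′≼h → l′≰h (≼-trans (All.head (Allₚ.++⁻ʳ (r ∷ rs′) rungs)) h′≼h))
          (proj₁ (proj₂ (AllPairs-++⁻ (r ∷ rs′) steps)) , Allₚ.++⁻ˡ (r ∷ rs′) rungs))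
        (tower (proj₁ (All.head ss))))
    where open IsLadder lad

  -- The elements above a tower of type `ms` form an up-set. The elements outside it are handled by
  -- induction, and inside it there is no ladder of m + 2 rungs by `capped-ladder`.
  tower-free-bound : (∀ (P : Pred A 0ℓ) → ¬ ¬ Decidable₁ P) → ∀ ms {S} → (∀ {z} → S z → ¬ Tower O ms z) →
                     ∀ L → GrundyBound O S (ω L) (towerBound ms L)
  tower-free-bound em []       free L {[]}    g inS width = z≤n
  tower-free-bound em []       free L {j ∷ J} g inS width =
    ⊥-elim (free (inS (here refl) (proj₂ (Grundy.inhabited g (here refl)))) base)
  -- The inequality to be proved is decidable, hence stable, so having a tower may be taken as
  -- decidable under a double negation.
  tower-free-bound em (m ∷ ms) {S} free L {J} {D} g inS width = decidable-stable (_ ≤? _) λ ¬bound →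
    em (Tower O ms) λ tower? → ¬bound (product-bound O tower? Tower-up g (low tower?) (high tower?))
    where
    sub-width : ∀ {J′} {P : Pred A 0ℓ} (P? : Decidable₁ P) → (∀ {j} → j ∈ J′ → j ∈ J) →
                Width (Elem J′ (Window.cut O P? D)) (ω L)
    sub-width P? J′⊆ ys es = width ys (All.map (λ (j , j∈ , x∈) → j , J′⊆ j∈ , proj₁ (∈-filter⁻ P? x∈)) es)
    low : (tower? : Decidable₁ (Tower O ms)) → ∀ {J′} → Grundy O J′ (Window.cut O (¬? ∘ tower?) D) →
          (∀ {j} → j ∈ J′ → j ∈ J) → length J′ ≤ towerBound ms L
    low tower? g′ J′⊆ = tower-free-bound em ms {λ z → ¬ Tower O ms z} (λ ¬t → ¬t) L g′
      (λ {j} _ x∈ → proj₂ (∈-filter⁻ (¬? ∘ tower?) {xs = D j} x∈)) (sub-width (¬? ∘ tower?) J′⊆)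
    high : (tower? : Decidable₁ (Tower O ms)) → ∀ {J′} → Grundy O J′ (Window.cut O tower? D) →
           (∀ {j} → j ∈ J′ → j ∈ J) → length J′ ≤ ladderBound (suc m) L
    high tower? g′ J′⊆ = ladder-free-bound O {λ z → S z × Tower O ms z} (suc m)
      (capped-ladder (free ∘ proj₁) proj₂) L g′
      (λ {j} j∈ x∈ → let x∈D , t = ∈-filter⁻ tower? {xs = D j} x∈ in inS (J′⊆ j∈) x∈D , t) (sub-width tower? J′⊆)

rungCount : List ℕ → ℕ
rungCount []       = 0
rungCount (m ∷ ms) = suc m + rungCount ms

-- The successors of the bounds multiply over the stages, so the exponents add. For L ≥ 1 the
-- exponent L * (7 + 2(m + 1) + 4L) of a stage is at most 13(m + 1)L², as 7 + 2 + 4 = 13; for L = 0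
-- both vanish.
towerBound-≤ : ∀ ms L → suc (towerBound ms L) ≤ 2 ^ (13 * rungCount ms * (L * L))
towerBound-≤ []       L = ≤-refl
towerBound-≤ (m ∷ ms) L = begin
  suc (suc kl * kh + kl)                ≡⟨ cong suc (+-comm (suc kl * kh) kl) ⟩
  suc kl + suc kl * kh                  ≡⟨ sym (*-suc (suc kl) kh) ⟩
  suc kl * suc kh                       ≤⟨ *-mono-≤ (towerBound-≤ ms L) (ladderBound-≤ (suc m) L) ⟩
  2 ^ (13 * rungCount ms * (L * L)) * 2 ^ (L * (7 + 2 * suc m + 4 * L)) ≡⟨ sym (^-distribˡ-+-* 2 (13 * rungCount ms * (L * L)) _) ⟩
  2 ^ (13 * rungCount ms * (L * L) + L * (7 + 2 * suc m + 4 * L)) ≤⟨ ^-monoʳ-≤ 2 (+-monoʳ-≤ (13 * rungCount ms * (L * L)) (exponent L)) ⟩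
  2 ^ (13 * rungCount ms * (L * L) + 13 * suc m * (L * L)) ≡⟨ cong (2 ^_) (collect (rungCount ms) m (L * L)) ⟩
  2 ^ (13 * rungCount (m ∷ ms) * (L * L)) ∎
  where
  open ≤-Reasoning
  kl = towerBound ms L
  kh = ladderBound (suc m) L
  collect : ∀ r m s → 13 * r * s + 13 * suc m * s ≡ 13 * (suc m + r) * s
  collect = solve-∀
  exponent : ∀ L → L * (7 + 2 * suc m + 4 * L) ≤ 13 * suc m * (L * L)
  exponent zero    = z≤n
  exponent (suc l) = ≤-trans (m≤m+n _ (suc l * (9 * l + m * (11 + 13 * l)))) (≤-reflexive (spread m l))
    where
    spread : ∀ m l → suc l * (7 + 2 * suc m + 4 * suc l) + suc l * (9 * l + m * (11 + 13 * l)) ≡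
             13 * suc m * (suc l * suc l)
    spread = solve-∀

-- Embedding the members of 𝒬 into towers.

posetOrder : ∀ {n} → FinPoset n → DecPreorder (Fin n)
posetOrder P = record { _≼_ = _≼_ ; ≼-refl = IsDecPartialOrder.refl isDecPartialOrder
                      ; ≼-trans = IsDecPartialOrder.trans isDecPartialOrder ; _≼?_ = _≼?_ }
  where open FinPoset P

AllPairs-lookup-< : ∀ {A : Set} {R : Rel A 0ℓ} {xs} → AllPairs R xs → ∀ {i j} → i Fin.< j → R (lookup xs i) (lookup xs j)
AllPairs-lookup-< (r ∷ _)  {Fin.zero}  {Fin.suc j} _         = All.lookup r (∈-lookup j)
AllPairs-lookup-< (_ ∷ rs) {Fin.suc i} {Fin.suc j} (s≤s i<j) = AllPairs-lookup-< rs i<j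

module Rank {n : ℕ} {_⊴_ : Rel (Fin n) 0ℓ} (_⊴?_ : Decidable _⊴_) (⊴-trans : Transitive _⊴_)
            (⊴-total : ∀ x y → x ⊴ y ⊎ y ⊴ x) where

  NotAbove? : ∀ x → Decidable₁ (λ y → ¬ x ⊴ y)
  NotAbove? x y = ¬? (x ⊴? y)

  -- As `⊴` is total, these are the elements strictly before x, and their number is the position of
  -- x.
  below : Fin n → List (Fin n)
  below x = filter (NotAbove? x) (allFin n)

  below-unique : ∀ x → Unique (below x)
  below-unique x = AllPairsₚ.filter⁺ (NotAbove? x) (allFin⁺ n)

  not-self : ∀ {x} → ¬ x ∈ below x
  not-self {x} x∈ = proj₂ (∈-filter⁻ (NotAbove? x) {xs = allFin n} x∈) ([ id , id ]′ (⊴-total x x))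

  below⁺ : ∀ {x y} → ¬ x ⊴ y → y ∈ below x
  below⁺ {x} ¬p = ∈-filter⁺ (NotAbove? x) (∈-allFin _) ¬p

  below⁻ : ∀ {x y} → y ∈ below x → ¬ x ⊴ y
  below⁻ {x} y∈ = proj₂ (∈-filter⁻ (NotAbove? x) {xs = allFin n} y∈)

  rank<n : ∀ x → length (below x) < n
  rank<n x = ≤-trans (Unique-length-≤ {xs = x ∷ below x} {allFin n} (Allₚ.¬Any⇒All¬ _ not-self ∷ below-unique x) (λ _ → ∈-allFin _))
                     (≤-reflexive (length-tabulate id))

  rank : Fin n → Fin n
  rank x = Fin.fromℕ< (rank<n x)

  rank-mono : ∀ {x y} → x ⊴ y → rank x Fin.≤ rank y
  rank-mono {x} {y} x⊴y = subst₂ _≤_ (sym (Finₚ.toℕ-fromℕ< (rank<n x))) (sym (Finₚ.toℕ-fromℕ< (rank<n y)))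
    (Unique-length-≤ (below-unique x) λ z∈ → below⁺ λ y⊴z → below⁻ z∈ (⊴-trans x⊴y y⊴z))

  rank-cancel : ∀ {x y} → rank x Fin.≤ rank y → x ⊴ y
  rank-cancel {x} {y} le with x ⊴? y
  ... | yes p = p
  ... | no ¬p = contradiction (subst₂ _≤_ (Finₚ.toℕ-fromℕ< (rank<n x)) (Finₚ.toℕ-fromℕ< (rank<n y)) le)
    (<⇒≱ (Unique-length-≤ {xs = y ∷ below y} {below x} (Allₚ.¬Any⇒All¬ _ not-self ∷ below-unique y) λ
      { (here refl) → below⁺ ¬p
      ; (there z∈)  → below⁺ λ x⊴z → below⁻ z∈ (⊴-trans ([ (λ p → contradiction p ¬p) , id ]′ (⊴-total x y)) x⊴z) }))

module _ {A : Set} (O : DecPreorder A) {B : Set} (_⊑ᴮ_ : Rel B 0ℓ) where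
  open DecPreorder O hiding (Grundy; IsLadder)

  record Placement (ms : List ℕ) (z : A) : Set where
    field
      place  : B → A
      floor  : A
      tower  : Tower O ms floor
      floor≼ : floor ≼ z
      above  : ∀ b → floor ≼ place b
      under  : ∀ b → place b ≺ z
      mono   : ∀ {b c} → b ⊑ᴮ c → place b ≼ place c
      cancel : ∀ {b c} → place b ≼ place c → b ⊑ᴮ c

-- The arbitrary tail `ms` in `placement` is what allows embeddings to be stacked.
record TowerEmbedding {B : Set} (_⊑ᴮ_ : Rel B 0ℓ) (size : ℕ) : Set₁ where
  field
    shape     : List ℕ
    rungs≤    : rungCount shape ≤ size
    placement : ∀ {A} (O : DecPreorder A) {ms z} → Tower O (shape ++ ms) z → Placement O _⊑ᴮ_ ms z

module _ {n : ℕ} (Q : FinPoset n) (C : Subset n) (chain-C : FinPoset.IsChain Q C) (chain-∁C : FinPoset.IsChain Q (∁ C))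
         (ascending : ∀ x y → x ∈ₛ C → y ∈ₛ ∁ C → FinPoset.Comparable Q x y → FinPoset._≺_ Q x y) where
  open FinPoset Q using (_≼_; _≼?_; isDecPartialOrder)
  private module Q = IsDecPartialOrder isDecPartialOrder

  -- The linear order that puts x ∈ C before y ∉ C exactly when x ≼ y.
  data _⊴_ (x y : Fin n) : Set where
    related : x ≼ y → x ⊴ y
    crossed : x ∈ₛ ∁ C → y ∈ₛ C → ¬ y ≼ x → x ⊴ y

  no-descent : ∀ {x y} → x ∈ₛ ∁ C → y ∈ₛ C → ¬ x ≼ y
  no-descent x∉ y∈ x≼y = let y≼x , y≢x = ascending _ _ y∈ x∉ (inj₂ x≼y) in y≢x (Q.antisym y≼x x≼y)

  side : ∀ x → x ∈ₛ C ⊎ x ∈ₛ ∁ C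
  side x with x ∈? C
  ... | yes x∈ = inj₁ x∈
  ... | no x∉  = inj₂ (x∉p⇒x∈∁p x∉)

  ⊴-trans : Transitive _⊴_
  ⊴-trans (related p) (related q) = related (Q.trans p q)
  ⊴-trans {x} (related x≼y) (crossed y∉ z∈ z≰y) with side x
  ... | inj₂ x∉ = crossed x∉ z∈ λ z≼x → z≰y (Q.trans z≼x x≼y)
  ... | inj₁ x∈ with chain-C _ _ x∈ z∈
  ... | inj₁ x≼z = related x≼z
  ... | inj₂ z≼x = contradiction (Q.trans z≼x x≼y) z≰y
  ⊴-trans {_} {_} {z} (crossed x∉ y∈ y≰x) (related y≼z) with side z
  ... | inj₁ z∈ = crossed x∉ z∈ λ z≼x → y≰x (Q.trans y≼z z≼x)
  ... | inj₂ z∉ with chain-∁C _ _ x∉ z∉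
  ... | inj₁ x≼z = related x≼z
  ... | inj₂ z≼x = contradiction (Q.trans y≼z z≼x) y≰x
  ⊴-trans (crossed _ y∈ _) (crossed y∉ _ _) = contradiction y∈ (x∈∁p⇒x∉p y∉)

  ⊴-total : ∀ x y → x ⊴ y ⊎ y ⊴ x
  ⊴-total x y with side x | side y
  ... | inj₁ x∈ | inj₁ y∈ = [ inj₁ ∘ related , inj₂ ∘ related ]′ (chain-C _ _ x∈ y∈)
  ... | inj₂ x∉ | inj₂ y∉ = [ inj₁ ∘ related , inj₂ ∘ related ]′ (chain-∁C _ _ x∉ y∉)
  ... | inj₁ x∈ | inj₂ y∉ with x ≼? y
  ...   | yes p = inj₁ (related p)
  ...   | no ¬p = inj₂ (crossed y∉ x∈ ¬p)
  ⊴-total x y | inj₂ x∉ | inj₁ y∈ with y ≼? x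
  ...   | yes p = inj₂ (related p)
  ...   | no ¬p = inj₁ (crossed x∉ y∈ ¬p)

  _⊴?_ : Decidable _⊴_
  x ⊴? y with x ≼? y
  ... | yes p = yes (related p)
  ... | no ¬p with side x | side y | y ≼? x
  ... | inj₂ x∉ | inj₁ y∈ | no y≰x  = yes (crossed x∉ y∈ y≰x)
  ... | inj₁ x∈ | _       | _       = no λ { (related p) → ¬p p ; (crossed x∉ _ _) → x∈∁p⇒x∉p x∉ x∈ }
  ... | _       | inj₂ y∉ | _       = no λ { (related p) → ¬p p ; (crossed _ y∈ _) → x∈∁p⇒x∉p y∉ y∈ }
  ... | _       | _       | yes y≼x = no λ { (related p) → ¬p p ; (crossed _ _ y≰x) → y≰x y≼x }

  open Rank _⊴?_ ⊴-trans ⊴-total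

  -- Each element goes to the rung given by its position in `⊴`: to the foot if it is in C, to the
  -- head otherwise. Then x in C is below y outside C exactly when the rank of x is at most that of
  -- y, which is how feet and heads of a ladder compare.
  ladder-placement : ∀ {A} (O : DecPreorder A) {r rs ms z} → IsLadder O (r ∷ rs) → length (r ∷ rs) ≡ n →
                     All (λ p → DecPreorder._≺_ O (proj₂ p) z) (r ∷ rs) → Tower O ms (proj₁ r) → Placement O _≼_ ms z
  ladder-placement {A} O {r} {rs} {ms} {z} lad refl below-z t = record
    { place = place ; floor = proj₁ r ; tower = t
    ; floor≼ = O.≼-trans (O.≼-trans (bottom-l Fin.zero) (rung Fin.zero)) (proj₁ (under-h Fin.zero))
    ; above = above ; under = under ; mono = mono ; cancel = cancel }
    where
    module O = DecPreorder O
    open IsLadder lad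
    l h : Fin (length (r ∷ rs)) → A
    l i = proj₁ (lookup (r ∷ rs) i)
    h i = proj₂ (lookup (r ∷ rs) i)
    rung : ∀ i → l i O.≼ h i
    rung i = All.lookup rungs (∈-lookup i)
    under-h : ∀ i → h i O.≺ z
    under-h i = All.lookup below-z (∈-lookup i)
    climb : ∀ {i j} → i Fin.≤ j → l i O.≼ l j × h i O.≼ h j
    climb {i} {j} i≤j with m≤n⇒m<n∨m≡n i≤j
    ... | inj₁ i<j = let a , _ , b = AllPairs-lookup-< steps i<j in a , b
    ... | inj₂ eq with Finₚ.toℕ-injective eq
    ... | refl = O.≼-refl , O.≼-refl
    bottom-l : ∀ i → proj₁ r O.≼ l i
    bottom-l i = proj₁ (climb {Fin.zero} {i} z≤n)
    below-rung : ∀ {i j} → l i O.≼ h j → i Fin.≤ j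
    below-rung {i} {j} p with Fin._≤?_ i j
    ... | yes i≤j = i≤j
    ... | no i≰j  = contradiction p (proj₁ (proj₂ (AllPairs-lookup-< steps (≰⇒> i≰j))))
    select : ∀ x → x ∈ₛ C ⊎ x ∈ₛ ∁ C → A
    select x (inj₁ _) = l (rank x)
    select x (inj₂ _) = h (rank x)
    place : Fin n → A
    place x = select x (side x)
    above : ∀ x → proj₁ r O.≼ place x
    above x with side x
    ... | inj₁ _ = bottom-l (rank x)
    ... | inj₂ _ = O.≼-trans (bottom-l (rank x)) (rung (rank x))
    under : ∀ x → place x O.≺ z
    under x with side x
    ... | inj₁ _ = O.≼-trans (rung (rank x)) (proj₁ (under-h (rank x))) ,
                   λ z≼l → proj₂ (under-h (rank x)) (O.≼-trans z≼l (rung (rank x)))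
    ... | inj₂ _ = under-h (rank x)
    mono : ∀ {x y} → x ≼ y → place x O.≼ place y
    mono {x} {y} x≼y with side x | side y
    ... | inj₁ _  | inj₁ _  = proj₁ (climb (rank-mono (related x≼y)))
    ... | inj₁ _  | inj₂ _  = O.≼-trans (proj₁ (climb (rank-mono (related x≼y)))) (rung (rank y))
    ... | inj₂ _  | inj₂ _  = proj₂ (climb (rank-mono (related x≼y)))
    ... | inj₂ x∉ | inj₁ y∈ = contradiction x≼y (no-descent x∉ y∈)
    uncross : ∀ {x y} → x ⊴ y → ¬ (x ∈ₛ ∁ C × y ∈ₛ C) → x ≼ y
    uncross (related p)       _ = p
    uncross (crossed x∉ y∈ _) f = contradiction (x∉ , y∈) f
    cancel : ∀ {x y} → place x O.≼ place y → x ≼ y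
    cancel {x} {y} p with side x | side y
    ... | inj₁ x∈ | inj₁ _  = uncross (rank-cancel (below-rung (O.≼-trans p (rung (rank y))))) λ (x∉ , _) → x∈∁p⇒x∉p x∉ x∈
    ... | inj₁ x∈ | inj₂ _  = uncross (rank-cancel (below-rung p)) λ (x∉ , _) → x∈∁p⇒x∉p x∉ x∈
    ... | inj₂ _  | inj₂ y∉ = uncross (rank-cancel (below-rung (O.≼-trans (rung (rank x)) p))) λ (_ , y∈) → x∈∁p⇒x∉p y∉ y∈
    ... | inj₂ _  | inj₁ _  = contradiction p (upwards (∈-lookup (rank x)) (∈-lookup (rank y)))

ladder-embedding : ∀ {n} (Q : FinPoset n) → LadderLike Q → TowerEmbedding (FinPoset._≼_ Q) n
ladder-embedding {zero} Q _ = record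
  { shape = [] ; rungs≤ = z≤n
  ; placement = λ O t → record
      { place = λ () ; floor = _ ; tower = t ; floor≼ = DecPreorder.≼-refl O
      ; above = λ () ; under = λ () ; mono = λ { {()} } ; cancel = λ { {()} } } }
ladder-embedding {suc n} Q (C , cC , c∁C , asc) = record
  -- A stage of type n has n + 1 rungs, one for each element.
  { shape = n ∷ [] ; rungs≤ = ≤-reflexive (+-identityʳ (suc n))
  ; placement = λ { O (stage lad len below t) → ladder-placement Q C cC c∁C asc O lad (cong suc len) below t } }

total : ∀ k → (Fin k → ℕ) → ℕ
total zero    s = 0
total (suc k) s = s Fin.zero + total k (s ∘ Fin.suc)

Cell : ∀ {k} → (Fin k → ℕ) → Set
Cell {k} s = Σ (Fin k) λ i → Fin (s i)

shift : ∀ {k} {s : Fin (suc k) → ℕ} → Cell (s ∘ Fin.suc) → Cell s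
shift (i , x) = Fin.suc i , x

first : ∀ {k} (s : Fin (suc k) → ℕ) → Fin (s Fin.zero) → Cell s
first s x = Fin.zero , x

-- Serves to count the elements of a series composition, which bounds its rungs by the size of the
-- isomorphic poset.
cells : ∀ k (s : Fin k → ℕ) → List (Cell s)
cells zero    s = []
cells (suc k) s = map (first s) (allFin (s Fin.zero)) ++ map (shift {s = s}) (cells k (s ∘ Fin.suc))

length-cells : ∀ k s → length (cells k s) ≡ total k s
length-cells zero    s = refl
length-cells (suc k) s = trans (length-++ (map (first s) (allFin (s Fin.zero))))
  (cong₂ _+_ (trans (length-map (first s) (allFin (s Fin.zero))) (length-tabulate id))
             (trans (length-map (shift {s = s}) (cells k (s ∘ Fin.suc))) (length-cells k (s ∘ Fin.suc))))

cells-unique : ∀ k s → Unique (cells k s)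
cells-unique zero    s = []
cells-unique (suc k) s = AllPairsₚ.++⁺
  (AllPairsₚ.map⁺ (AllPairs.map (λ { x≢y refl → x≢y refl }) (allFin⁺ (s Fin.zero))))
  (AllPairsₚ.map⁺ (AllPairs.map (λ { x≢y refl → x≢y refl }) (cells-unique k (s ∘ Fin.suc))))
  (Allₚ.map⁺ (All.tabulate λ _ → Allₚ.map⁺ (All.tabulate λ _ ())))

-- The list of shapes runs from the top ladder down, so the first component comes last.
series-embedding : ∀ k {s : Fin k → ℕ} (S : ∀ i → FinPoset (s i)) →
                   (∀ i → TowerEmbedding (FinPoset._≼_ (S i)) (s i)) → TowerEmbedding (SeriesOrder S) (total k s)
series-embedding zero    S es = record
  { shape = [] ; rungs≤ = z≤n
  ; placement = λ O t → record
      { place = λ () ; floor = _ ; tower = t ; floor≼ = DecPreorder.≼-refl O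
      ; above = λ () ; under = λ () ; mono = λ { {()} } ; cancel = λ { {()} } } }
series-embedding (suc k) {s} S es = record
  { shape     = upper.shape ++ lower.shape
  ; rungs≤    = ≤-trans (≤-reflexive (rungCount-++ upper.shape))
                  (≤-trans (+-mono-≤ upper.rungs≤ lower.rungs≤) (≤-reflexive (+-comm _ (s Fin.zero))))
  ; placement = combine
  }
  where
  module lower = TowerEmbedding (es Fin.zero)
  module upper = TowerEmbedding (series-embedding k (S ∘ Fin.suc) (es ∘ Fin.suc))
  rungCount-++ : ∀ ms {ns} → rungCount (ms ++ ns) ≡ rungCount ms + rungCount ns
  rungCount-++ []       = refl
  rungCount-++ (m ∷ ms) = cong suc (trans (cong (m +_) (rungCount-++ ms)) (sym (+-assoc m _ _)))
  combine : ∀ {A} (O : DecPreorder A) {ms z} → Tower O ((upper.shape ++ lower.shape) ++ ms) z →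
            Placement O (SeriesOrder S) ms z
  combine O {ms} {z} t = record
    { place  = place
    ; floor  = Low.floor
    ; tower  = Low.tower
    ; floor≼ = O.≼-trans Low.floor≼ Up.floor≼
    ; above  = λ { (Fin.zero , x) → Low.above x
                 ; (Fin.suc i , x) → O.≼-trans Low.floor≼ (Up.above (i , x)) }
    ; under  = λ { (Fin.zero , x) → ≺-≼-trans O (Low.under x) Up.floor≼
                 ; (Fin.suc i , x) → Up.under (i , x) }
    ; mono   = mono
    ; cancel = λ {b} {c} → cancel {b} {c}
    }
    where
    module O = DecPreorder O
    module Up = Placement (upper.placement O (subst (λ ns → Tower O ns z) (++-assoc upper.shape lower.shape ms) t))
    module Low = Placement (lower.placement O Up.tower)
    place : Cell s → _
    place (Fin.zero , x)  = Low.place x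
    place (Fin.suc i , x) = Up.place (i , x)
    mono : ∀ {b c} → SeriesOrder S b c → place b O.≼ place c
    mono (within {Fin.zero} p)                           = Low.mono p
    mono (within {Fin.suc i} p)                          = Up.mono (within p)
    mono (across {Fin.zero} {Fin.suc j} {x} {y} _)       = O.≼-trans (proj₁ (Low.under x)) (Up.above (j , y))
    mono (across {Fin.suc i} {Fin.suc j} (s≤s i<j))      = Up.mono (across i<j)
    unshift : ∀ {b c} → SeriesOrder (S ∘ Fin.suc) b c → SeriesOrder S (shift b) (shift c)
    unshift (within p)   = within p
    unshift (across i<j) = across (s≤s i<j)
    cancel : ∀ {b c} → place b O.≼ place c → SeriesOrder S b c
    cancel {Fin.zero , x}  {Fin.zero , y}  p = within (Low.cancel p)
    cancel {Fin.zero , x}  {Fin.suc j , y} p = across (s≤s z≤n)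
    cancel {Fin.suc i , x} {Fin.suc j , y} p = unshift (Up.cancel p)
    cancel {Fin.suc i , x} {Fin.zero , y}  p =
      contradiction (O.≼-trans (Up.above (i , x)) p) (proj₂ (Low.under y))

𝒬-embedding : ∀ {n} {Q : FinPoset n} → 𝒬 Q → TowerEmbedding (FinPoset._≼_ Q) n
𝒬-embedding {n} {Q} (ladder ll)                = ladder-embedding Q ll
𝒬-embedding {n} {Q} (series {k} {s} S qs (f , iso)) = record
  { shape     = E.shape
  ; rungs≤    = ≤-trans E.rungs≤ (subst₂ _≤_ (trans (length-map f (cells k s)) (length-cells k s)) (length-tabulate id)
                  (Unique-length-≤ (AllPairsₚ.map⁺ (AllPairs.map (λ x≢y eq → x≢y (injective eq)) (cells-unique k s)))
                    (λ _ → ∈-allFin _)))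
  ; placement = λ O t → let open Placement (E.placement O t) in record
      { place = place ∘ inv ; floor = floor ; tower = tower ; floor≼ = floor≼
      ; above = above ∘ inv ; under = under ∘ inv
      ; mono   = λ b≼c → mono (o-cancel (subst₂ _≼_ (sym (f-inv _)) (sym (f-inv _)) b≼c))
      ; cancel = λ p → subst₂ _≼_ (f-inv _) (f-inv _) (o-mono (cancel p))
      }
  }
  where
  open FinPoset Q using (_≼_)
  open IsOrderIsomorphism iso using (surjective; injective) renaming (mono to o-mono; cancel to o-cancel)
  module E = TowerEmbedding (series-embedding k S (λ i → 𝒬-embedding (qs i)))
  inv : Fin n → Cell s
  inv y = proj₁ (surjective y)
  f-inv : ∀ y → f (inv y) ≡ y
  f-inv y = proj₂ (surjective y) refl

-- From First-Fit runs to families of chains.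

elements : ∀ {n} → Subset n → List (Fin n)
elements []            = []
elements (inside  ∷ p) = Fin.zero ∷ map Fin.suc (elements p)
elements (outside ∷ p) = map Fin.suc (elements p)

length-elements : ∀ {n} (p : Subset n) → length (elements p) ≡ ∣ p ∣
length-elements []            = refl
length-elements (inside  ∷ p) = cong suc (trans (length-map Fin.suc (elements p)) (length-elements p))
length-elements (outside ∷ p) = trans (length-map Fin.suc (elements p)) (length-elements p)

∈-elements⁺ : ∀ {n} {p : Subset n} {x} → x ∈ₛ p → x ∈ elements p
∈-elements⁺ here                        = here refl
∈-elements⁺ {p = inside  ∷ p} (there x∈) = there (∈-map⁺ Fin.suc (∈-elements⁺ x∈))
∈-elements⁺ {p = outside ∷ p} (there x∈) = ∈-map⁺ Fin.suc (∈-elements⁺ x∈)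

∈-elements⁻ : ∀ {n} {p : Subset n} {x} → x ∈ elements p → x ∈ₛ p
∈-elements⁻ {p = inside  ∷ p} (here refl) = here
∈-elements⁻ {p = inside  ∷ p} (there x∈)  with ∈-map⁻ Fin.suc x∈
... | y , y∈ , refl = there (∈-elements⁻ y∈)
∈-elements⁻ {p = outside ∷ p} x∈          with ∈-map⁻ Fin.suc x∈
... | y , y∈ , refl = there (∈-elements⁻ y∈)

elements-unique : ∀ {n} (p : Subset n) → Unique (elements p)
elements-unique []            = []
elements-unique (inside  ∷ p) = Allₚ.map⁺ (All.universal (λ _ ()) (elements p)) ∷ map⁺ Finₚ.suc-injective (elements-unique p)
elements-unique (outside ∷ p) = map⁺ Finₚ.suc-injective (elements-unique p)

fromList : ∀ {n} → List (Fin n) → Subset n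
fromList = foldr (λ x p → ⁅ x ⁆ ∪ p) Data.Fin.Subset.⊥

∈-fromList⁺ : ∀ {n} {xs : List (Fin n)} {x} → x ∈ xs → x ∈ₛ fromList xs
∈-fromList⁺ (here refl) = x∈p∪q⁺ (inj₁ (x∈⁅x⁆ _))
∈-fromList⁺ (there x∈)  = x∈p∪q⁺ (inj₂ (∈-fromList⁺ x∈))

∈-fromList⁻ : ∀ {n} {xs : List (Fin n)} {x} → x ∈ₛ fromList xs → x ∈ xs
∈-fromList⁻ {xs = []}     x∈ = ⊥-elim (∉⊥ x∈)
∈-fromList⁻ {xs = y ∷ ys} x∈ with x∈p∪q⁻ ⁅ y ⁆ (fromList ys) x∈
... | inj₁ x∈y = here (x∈⁅y⁆⇒x≡y _ x∈y)
... | inj₂ x∈′ = there (∈-fromList⁻ x∈′)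

∣fromList∣ : ∀ {n} {xs : List (Fin n)} → Unique xs → ∣ fromList xs ∣ ≡ length xs
∣fromList∣ {xs = xs} u = trans (sym (length-elements (fromList xs)))
  (≤-antisym (Unique-length-≤ {ys = xs} (elements-unique (fromList xs)) (∈-fromList⁻ ∘ ∈-elements⁻))
             (Unique-length-≤ {ys = elements (fromList xs)} u (∈-elements⁺ ∘ ∈-fromList⁺)))

if-cases : ∀ {A X : Set} (d : Dec A) {t e : X} →
           A × (if does d then t else e) ≡ t ⊎ ¬ A × (if does d then t else e) ≡ e
if-cases (yes a) = inj₁ (a , refl)
if-cases (no ¬a) = inj₂ (¬a , refl)

module _ {n : ℕ} (P : FinPoset n) where
  open FinPoset P hiding (HasWidth; LadderLike; firstFit)
  open DecPreorder (posetOrder P) using (_∥_; ≼-refl; Width)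

  antichain-fromList : ∀ {ys} → AllPairs _∥_ ys → IsAntichain (fromList ys) × ∣ fromList ys ∣ ≡ length ys
  antichain-fromList {ys} ps = anti , ∣fromList∣ (AllPairs.map (λ { (p , _) refl → p ≼-refl }) ps)
    where
    anti : IsAntichain (fromList ys)
    anti x y x∈ y∈ x≢y with AllPairs-lookup ps (∈-fromList⁻ x∈) (∈-fromList⁻ y∈)
    ... | inj₁ eq             = contradiction eq x≢y
    ... | inj₂ (inj₁ (p , q)) = [ p , q ]′
    ... | inj₂ (inj₂ (p , q)) = [ q , p ]′

  HasWidth⇒Width : ∀ {w S} → HasWidth P w → Width S w
  HasWidth⇒Width (_ , max) ys _ ps = let anti , len = antichain-fromList ps in subst (_≤ _) len (max _ anti)

  Witnesses : Rel (Subset n) 0ℓ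
  Witnesses C C′ = ∀ {x} → x ∈ₛ C′ → ∃[ y ] y ∈ₛ C × ¬ Comparable x y

  Witnesses-∪ : ∀ {C C′ x} → Witnesses C C′ → Witnesses (C ∪ ⁅ x ⁆) C′
  Witnesses-∪ w z∈ = let y , y∈ , c = w z∈ in y , x∈p∪q⁺ (inj₁ y∈) , c

  -- The invariant of First-Fit: every element of a class was rejected by each earlier class, and
  -- incomparabilities persist as classes grow.
  record Outcome (Cs : List (Subset n)) : Set where
    field
      chains    : All (λ C → IsChain C × ∃ (_∈ₛ C)) Cs
      witnesses : AllPairs Witnesses Cs

  comparable? : Decidable Comparable
  comparable? x y = (x ≼? y) ⊎-dec (y ≼? x)

  Comparable-sym : ∀ {x y} → Comparable x y → Comparable y x
  Comparable-sym = [ inj₂ , inj₁ ]′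

  ∈-∪⁅⁆ : ∀ {C : Subset n} {x z} → z ∈ₛ C ∪ ⁅ x ⁆ → z ∈ₛ C ⊎ z ≡ x
  ∈-∪⁅⁆ {C} {x} z∈ with x∈p∪q⁻ C ⁅ x ⁆ z∈
  ... | inj₁ p = inj₁ p
  ... | inj₂ p = inj₂ (x∈⁅y⁆⇒x≡y x p)

  rejected : ∀ {C x} → IsChain C → ¬ IsChain (C ∪ ⁅ x ⁆) → ∃[ y ] y ∈ₛ C × ¬ Comparable x y
  rejected {C} {x} ch ¬ch with Finₚ.any? (λ y → (y ∈? C) ×-dec ¬? (comparable? x y))
  ... | yes w = w
  ... | no ¬w = contradiction ch′ ¬ch
    where
    with-x : ∀ {y} → y ∈ₛ C → Comparable x y
    with-x {y} y∈ = decidable-stable (comparable? x y) λ ¬c → ¬w (y , y∈ , ¬c)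
    ch′ : IsChain (C ∪ ⁅ x ⁆)
    ch′ a b a∈ b∈ with ∈-∪⁅⁆ {C} {x} a∈ | ∈-∪⁅⁆ {C} {x} b∈
    ... | inj₁ a∈C  | inj₁ b∈C  = ch a b a∈C b∈C
    ... | inj₁ a∈C  | inj₂ refl = Comparable-sym (with-x a∈C)
    ... | inj₂ refl | inj₁ b∈C  = with-x b∈C
    ... | inj₂ refl | inj₂ refl = inj₁ ≼-refl

  insert-cases : ∀ C Cs x → IsChain (C ∪ ⁅ x ⁆) × insert (C ∷ Cs) x ≡ (C ∪ ⁅ x ⁆) ∷ Cs ⊎
                            ¬ IsChain (C ∪ ⁅ x ⁆) × insert (C ∷ Cs) x ≡ C ∷ insert Cs x
  insert-cases C Cs x = if-cases (isChain? (C ∪ ⁅ x ⁆))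

  insert-witnessed : ∀ {C x} Cs → (∃[ y ] y ∈ₛ C × ¬ Comparable x y) → All (Witnesses C) Cs → All (Witnesses C) (insert Cs x)
  insert-witnessed {C} {x} []        w []       = (λ z∈ → subst (λ z → ∃[ y ] y ∈ₛ C × ¬ Comparable z y) (sym (x∈⁅y⁆⇒x≡y x z∈)) w) ∷ []
  insert-witnessed {C} {x} (C₀ ∷ Cs) w (a ∷ as) with insert-cases C₀ Cs x
  ... | inj₁ (_ , eq) = subst (All (Witnesses C)) (sym eq) ((λ z∈ → [ a , (λ { refl → w }) ]′ (∈-∪⁅⁆ z∈)) ∷ as)
  ... | inj₂ (_ , eq) = subst (All (Witnesses C)) (sym eq) (a ∷ insert-witnessed Cs w as)

  singleton-chain : ∀ x → IsChain ⁅ x ⁆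
  singleton-chain x a b a∈ b∈ with x∈⁅y⁆⇒x≡y x a∈ | x∈⁅y⁆⇒x≡y x b∈
  ... | refl | refl = inj₁ ≼-refl

  insert-outcome : ∀ Cs x → Outcome Cs → Outcome (insert Cs x)
  insert-outcome []       x _ = record { chains = (singleton-chain x , x , x∈⁅x⁆ x) ∷ [] ; witnesses = [] ∷ [] }
  insert-outcome (C ∷ Cs) x record { chains = (ch , ne) ∷ chs ; witnesses = w ∷ ws } with insert-cases C Cs x
  ... | inj₁ (ch′ , eq) = subst Outcome (sym eq) record
    { chains    = (ch′ , x , x∈p∪q⁺ (inj₂ (x∈⁅x⁆ x))) ∷ chs
    ; witnesses = All.map (λ {C′} → Witnesses-∪ {C} {C′}) w ∷ ws }
  ... | inj₂ (¬ch′ , eq) with insert-outcome Cs x record { chains = chs ; witnesses = ws }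
  ... | record { chains = chs′ ; witnesses = ws′ } = subst Outcome (sym eq) record
    { chains = (ch , ne) ∷ chs′ ; witnesses = insert-witnessed Cs (rejected ch ¬ch′) w ∷ ws′ }

  foldl-outcome : ∀ xs {Cs} → Outcome Cs → Outcome (foldl insert Cs xs)
  foldl-outcome []       o = o
  foldl-outcome (x ∷ xs) o = foldl-outcome xs (insert-outcome _ x o)

  firstFit-outcome : ∀ π → Outcome (firstFit P π)
  firstFit-outcome π = foldl-outcome (tabulate (π ⟨$⟩ʳ_)) record { chains = [] ; witnesses = [] }

  classes : List (Subset n) → ℕ → List (Fin n)
  classes []       _       = []
  classes (C ∷ Cs) zero    = elements C
  classes (C ∷ Cs) (suc j) = classes Cs j

  class : ∀ {S : Pred (Subset n) 0ℓ} {Cs j} → All S Cs → j < length Cs → ∃[ C ] S C × classes Cs j ≡ elements C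
  class {j = zero}  (s ∷ _)  _         = _ , s , refl
  class {j = suc j} (_ ∷ ss) (s≤s j<) = class ss j<

  class-pair : ∀ {R : Rel (Subset n) 0ℓ} {Cs l j} → AllPairs R Cs → l < j → j < length Cs →
               ∃[ B ] ∃[ C ] R B C × classes Cs l ≡ elements B × classes Cs j ≡ elements C
  class-pair {l = zero}  {suc j} (r ∷ _)  _         (s≤s j<) = let C , rC , eq = class r j< in _ , C , rC , refl , eq
  class-pair {l = suc l} {suc j} (_ ∷ rs) (s≤s l<j) (s≤s j<) = class-pair rs l<j j<

  outcome-Grundy : ∀ {Cs} → Outcome Cs → Grundy (posetOrder P) (downFrom (length Cs)) (classes Cs)
  outcome-Grundy {Cs} o = record
    { decreasing = AllPairsₚ.applyDownFrom⁺₁ id (length Cs) (λ j<i _ → j<i)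
    ; chain      = λ j∈ x∈ y∈ → let C , (ch , _) , eq = class chains (∈-downFrom⁻ j∈) in
                     ch _ _ (∈-elements⁻ (subst (_ ∈_) eq x∈)) (∈-elements⁻ (subst (_ ∈_) eq y∈))
    ; inhabited  = λ j∈ → let C , (_ , x , x∈) , eq = class chains (∈-downFrom⁻ j∈) in
                     x , subst (x ∈_) (sym eq) (∈-elements⁺ x∈)
    ; witness    = λ j∈ l∈ l<j x∈ →
        let B , C , w , eqB , eqC = class-pair witnesses l<j (∈-downFrom⁻ j∈)
            y , y∈ , ¬c = w (∈-elements⁻ (subst (_ ∈_) eqC x∈))
        in y , subst (y ∈_) (sym eqB) (∈-elements⁺ y∈) , (¬c ∘ inj₁) , (¬c ∘ inj₂)
    } where open Outcome o

-- The upper bound for 𝒬.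

¬¬-decide : ∀ {n} (P : Pred (Fin n) 0ℓ) → ¬ ¬ Decidable₁ P
¬¬-decide {zero}  P ¬d = ¬d λ ()
¬¬-decide {suc n} P ¬d = ¬¬-decide (P ∘ Fin.suc) λ d →
  let cons = λ d₀ → ¬d λ { Fin.zero → d₀ ; (Fin.suc i) → d i }
  -- The refutation is applied to a negative answer at index zero, and the proof that would
  -- contradict that answer gives the positive one.
  in cons (no λ p → cons (yes p))

tower-monomorphism : ∀ {m n} (Q : FinPoset m) (P : FinPoset n) (e : TowerEmbedding (FinPoset._≼_ Q) m) {z} →
                     Tower (posetOrder P) (TowerEmbedding.shape e) z → Q ⊑ P
tower-monomorphism Q P e {z} t = place , record
  { isOrderHomomorphism = record { cong = cong place ; mono = mono }
  ; injective           = λ eq → IsDecPartialOrder.antisym (FinPoset.isDecPartialOrder Q)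
                            (cancel (subst (FinPoset._≼_ P _) eq P.≼-refl)) (cancel (subst (FinPoset._≼_ P _) (sym eq) P.≼-refl))
  ; cancel              = cancel
  }
  where
  module P = DecPreorder (posetOrder P)
  open TowerEmbedding e
  open Placement (placement (posetOrder P) (subst (λ ns → Tower (posetOrder P) ns z) (sym (++-identityʳ shape)) t))

module _ {n : ℕ} (Q : FinPoset n) (q : 𝒬 Q) {N : ℕ} (P : FinPoset N) (free : (Q -Free) P) (π : Permutation′ N) where

  firstFit-≤ : ∀ {w} L → w ≤ ω L → HasWidth P w → length (firstFit P π) ≤ 2 ^ (13 * n * (L * L))
  firstFit-≤ {w} L w≤ hw = begin
    length (firstFit P π)                  ≡⟨ sym (length-downFrom _) ⟩
    length (downFrom (length (firstFit P π))) ≤⟨ tower-free-bound (posetOrder P) ¬¬-decide shape {λ _ → ⊤}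
                                                (λ _ t → free (tower-monomorphism Q P (𝒬-embedding q) t)) L
                                                (outcome-Grundy P (firstFit-outcome P π)) (λ _ _ → tt)
                                                (λ ys es ps → ≤-trans (HasWidth⇒Width P hw ys es ps) w≤) ⟩
    towerBound shape L                     ≤⟨ n≤1+n _ ⟩
    suc (towerBound shape L)               ≤⟨ towerBound-≤ shape L ⟩
    2 ^ (13 * rungCount shape * (L * L))   ≤⟨ ^-monoʳ-≤ 2 (*-monoˡ-≤ (L * L) (*-monoʳ-≤ 13 rungs≤)) ⟩
    2 ^ (13 * n * (L * L))                 ∎
    where
    open ≤-Reasoning
    open TowerEmbedding (𝒬-embedding q)

-- The case w = 1, where lg w = 0 and the claimed bound is 1. The general estimate rounds the
-- logarithm up and is too weak there.
Grundy-width-1 : ∀ {A} {O : DecPreorder A} {J D} → Grundy O J D → DecPreorder.Width O (Elem J D) 1 → length J ≤ 1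
Grundy-width-1 {J = []}        g width = z≤n
Grundy-width-1 {J = _ ∷ []}    g width = ≤-refl
Grundy-width-1 {J = j ∷ l ∷ J} g width with Grundy.inhabited g (here refl)
... | x , x∈ with Grundy.witness g (here refl) (there (here refl)) (All.head (AllPairs.head (Grundy.decreasing g))) x∈
... | y , y∈ , x∥y = contradiction
  (width (x ∷ y ∷ []) ((j , here refl , x∈) ∷ (l , there (here refl) , y∈) ∷ []) ((x∥y ∷ []) ∷ [] ∷ []))
  λ { (s≤s ()) }

binary-log : ∀ w → 1 ≤ w → ∃[ e ] 2 ^ e ≤ w × w < 2 ^ suc e
binary-log (suc zero)    _ = 0 , s≤s z≤n , s≤s (s≤s z≤n)
binary-log (suc (suc w)) _ with binary-log (suc w) (s≤s z≤n)
... | e , lo , hi with suc (suc w) <? 2 ^ suc e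
... | yes lt = e , m≤n⇒m≤1+n lo , lt
... | no ¬lt = suc e , ≮⇒≥ ¬lt , ≤-<-trans hi (^-monoʳ-< 2 (s≤s (s≤s z≤n)) (n<1+n (suc e)))

-- Here e is the integer part of lg w, so e * q ≤ p. For e ≥ 1 the number e + 1 of doubling rounds
-- is at most 2e, and squaring turns 13 into 4 * 13 = 52.
lg²-bound : ∀ {m n w e} p q → 2 ^ e ≤ w → 1 ≤ e → w ^ q ≤ 2 ^ p →
            m ≤ 2 ^ (13 * n * (suc e * suc e)) → m ^ (q * q) ≤ 2 ^ (52 * n * (p * p))
lg²-bound {m} {n} {w} {e} p q lo 1≤e hyp m≤ = begin
  m ^ (q * q)                                    ≤⟨ ^-monoˡ-≤ (q * q) m≤ ⟩
  (2 ^ (13 * n * (suc e * suc e))) ^ (q * q)     ≡⟨ ^-*-assoc 2 (13 * n * (suc e * suc e)) (q * q) ⟩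
  2 ^ (13 * n * (suc e * suc e) * (q * q))       ≡⟨ cong (2 ^_) (regroup n (suc e) q) ⟩
  2 ^ (13 * n * ((suc e * q) * (suc e * q)))     ≤⟨ ^-monoʳ-≤ 2 (*-monoʳ-≤ (13 * n) (*-mono-≤ Lq≤2p Lq≤2p)) ⟩
  2 ^ (13 * n * ((2 * p) * (2 * p)))             ≡⟨ cong (2 ^_) (regroup′ n p) ⟩
  2 ^ (52 * n * (p * p))                         ∎
  where
  open ≤-Reasoning
  regroup : ∀ n L q → 13 * n * (L * L) * (q * q) ≡ 13 * n * ((L * q) * (L * q))
  regroup = solve-∀
  regroup′ : ∀ n p → 13 * n * ((2 * p) * (2 * p)) ≡ 52 * n * (p * p)
  regroup′ = solve-∀
  eq≤p : e * q ≤ p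
  eq≤p = ≮⇒≥ λ p<eq → <⇒≱ (^-monoʳ-< 2 (s≤s (s≤s z≤n)) p<eq)
    (≤-trans (≤-reflexive (sym (^-*-assoc 2 e q))) (≤-trans (^-monoˡ-≤ q lo) hyp))
  Lq≤2p : suc e * q ≤ 2 * p
  Lq≤2p = ≤-trans (*-monoˡ-≤ q (+-monoˡ-≤ e 1≤e)) (≤-trans (≤-reflexive (double e q)) (*-monoʳ-≤ 2 eq≤p))
    where
    double : ∀ e q → (e + e) * q ≡ 2 * (e * q)
    double = solve-∀

upper-bound : ∀ n (Q : FinPoset n) → 𝒬 Q → ∀ w → 1 ≤ w → ∀ m → m ≤FF[ w , Q ] → m ≤2^[ 52 * n ·lg² w ]
-- A positive q makes the power of 0 vanish.
upper-bound n Q q w 1≤w m (zero refl)                 p (suc q′) _ = z≤n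
upper-bound n Q q w 1≤w m (attained P π hw free m≤ff) p q′ hyp with binary-log w 1≤w
... | suc e , lo , hi = lg²-bound {n = n} {w} p q′ lo (s≤s z≤n) hyp
  (≤-trans m≤ff (firstFit-≤ Q q P free π (suc (suc e)) (≤-pred (subst (w <_) (sym (1+ω≡2^ (suc (suc e)))) hi)) hw))
... | zero , lo , hi = begin
  m ^ (q′ * q′)             ≤⟨ ^-monoˡ-≤ (q′ * q′) (≤-trans m≤ff ff≤1) ⟩
  1 ^ (q′ * q′)             ≡⟨ ^-zeroˡ (q′ * q′) ⟩
  1                         ≤⟨ m^n>0 2 (52 * n * (p * p)) ⟩
  2 ^ (52 * n * (p * p))    ∎
  where
  open ≤-Reasoning
  ff≤1 : length (firstFit P π) ≤ 1
  ff≤1 = subst (_≤ 1) (length-downFrom _) (Grundy-width-1 (outcome-Grundy P (firstFit-outcome P π))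
    λ ys es ps → ≤-trans (HasWidth⇒Width P hw ys es ps) (≤-pred hi))

-- First-Fit on greedy colourings.

-- Presenting the elements in order of increasing colour makes First-Fit reproduce the colouring.
module _ {n : ℕ} (P : FinPoset n) (γ : Fin n → ℕ)
         (proper : ∀ {x y} → γ x ≡ γ y → FinPoset.Comparable P x y)
         (greedy : ∀ x {l} → l < γ x → ∃[ y ] γ y ≡ l × ¬ FinPoset.Comparable P x y) where
  open FinPoset P using (insert; IsChain)

  -- The list holds the seen parts of the colour classes i, i + 1 and so on; its end means that all
  -- seen colours are below the index reached.
  Represents : ℕ → List (Subset n) → Pred (Fin n) 0ℓ → Set
  Represents i []       Seen = ∀ {y} → Seen y → γ y < i
  Represents i (C ∷ Cs) Seen = (∀ {y} → y ∈ₛ C → Seen y × γ y ≡ i) × (∀ {y} → Seen y → γ y ≡ i → y ∈ₛ C) ×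
                               Represents (suc i) Cs Seen

  Represents-lower : ∀ {i Seen x} Cs → γ x < i → Represents i Cs Seen → Represents i Cs (λ y → Seen y ⊎ y ≡ x)
  Represents-lower []       lt r = [ r , (λ { refl → lt }) ]′
  Represents-lower (C ∷ Cs) lt (sound , complete , r) =
    (λ y∈ → let s , e = sound y∈ in inj₁ s , e) ,
    (λ { (inj₁ s) e → complete s e ; (inj₂ refl) e → contradiction lt (<-irrefl e) }) ,
    Represents-lower Cs (m≤n⇒m≤1+n lt) r

  -- Each class of colour below γ x contains, by greediness, a seen element incomparable to x and
  -- rejects it. The class of colour γ x accepts x because the colouring is proper, and if it does
  -- not exist yet, the list ends exactly where it belongs.
  Represents-insert : ∀ {i Seen x} Cs → i ≤ γ x → (∀ {y} → γ y < γ x → ¬ FinPoset.Comparable P x y → Seen y) →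
                      Represents i Cs Seen → Represents i (insert Cs x) (λ y → Seen y ⊎ y ≡ x)
  Represents-insert {i} {Seen} {x} [] i≤ earlier r with m≤n⇒m<n∨m≡n i≤
  ... | inj₁ i<γx = let y , e , ¬c = greedy x i<γx in
    contradiction (r (earlier (subst (_< γ x) (sym e) i<γx) ¬c)) (<-irrefl e)
  ... | inj₂ refl =
    (λ y∈ → let e = x∈⁅y⁆⇒x≡y x y∈ in inj₂ e , cong γ e) ,
    (λ { (inj₁ s) e → contradiction (r s) (<-irrefl e) ; (inj₂ refl) _ → x∈⁅x⁆ x }) ,
    [ m≤n⇒m≤1+n ∘ r , (λ { refl → ≤-refl }) ]′
  Represents-insert {i} {Seen} {x} (C ∷ Cs) i≤ earlier (sound , complete , r) with insert-cases P C Cs x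
  ... | inj₁ (ch , eq) with m≤n⇒m<n∨m≡n i≤
  ...   | inj₁ i<γx = let y , e , ¬c = greedy x i<γx in
    contradiction (ch x y (x∈p∪q⁺ (inj₂ (x∈⁅x⁆ x)))
                          (x∈p∪q⁺ (inj₁ (complete (earlier (subst (_< γ x) (sym e) i<γx) ¬c) e)))) ¬c
  ...   | inj₂ refl = subst (λ Ds → Represents i Ds (λ y → Seen y ⊎ y ≡ x)) (sym eq)
    ( (λ y∈ → [ (λ y∈C → let s , e = sound y∈C in inj₁ s , e) , (λ e → inj₂ e , cong γ e) ]′ (∈-∪⁅⁆ P {C} {x} y∈))
    , (λ { (inj₁ s) e → x∈p∪q⁺ (inj₁ (complete s e)) ; (inj₂ refl) _ → x∈p∪q⁺ (inj₂ (x∈⁅x⁆ x)) })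
    , Represents-lower Cs ≤-refl r)
  Represents-insert {i} {Seen} {x} (C ∷ Cs) i≤ earlier (sound , complete , r) | inj₂ (¬ch , eq) with m≤n⇒m<n∨m≡n i≤
  ...   | inj₁ i<γx = subst (λ Ds → Represents i Ds (λ y → Seen y ⊎ y ≡ x)) (sym eq)
    ( (λ y∈ → let s , e = sound y∈ in inj₁ s , e)
    , (λ { (inj₁ s) e → complete s e ; (inj₂ refl) e → contradiction i<γx (<-irrefl (sym e)) })
    , Represents-insert Cs i<γx earlier r)
  ...   | inj₂ refl = contradiction (λ a b a∈ b∈ → proper (trans (colour a∈) (sym (colour b∈)))) ¬ch
    where
    colour : ∀ {a} → a ∈ₛ C ∪ ⁅ x ⁆ → γ a ≡ γ x
    colour a∈ = [ (λ a∈C → proj₂ (sound a∈C)) , cong γ ]′ (∈-∪⁅⁆ P {C} {x} a∈)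

  Represents-length : ∀ {i Seen y} Cs → Represents i Cs Seen → Seen y → γ y < i + length Cs
  Represents-length []       r           s = ≤-trans (r s) (≤-reflexive (sym (+-identityʳ _)))
  Represents-length (C ∷ Cs) (_ , _ , r) s = ≤-trans (Represents-length Cs r s) (≤-reflexive (sym (+-suc _ _)))

  -- Elements of smaller colour are seen or pending. As the list is sorted by colour, none is
  -- pending behind its head, so the head finds all its witnesses in place.
  foldl-colours : ∀ xs {Cs Seen} → AllPairs (λ x y → γ x ≤ γ y) xs →
                  (∀ {x y} → x ∈ xs → γ y < γ x → Seen y ⊎ y ∈ xs) → Represents 0 Cs Seen →
                  ∀ {y} → Seen y ⊎ y ∈ xs → γ y < length (foldl insert Cs xs)
  foldl-colours []       {Cs} _        _     r (inj₁ s) = Represents-length Cs r s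
  foldl-colours (x ∷ xs) {Cs} {Seen} (le ∷ les) cover r {y} y-in =
    foldl-colours xs les (λ x∈ lt → step (cover (there x∈) lt)) (Represents-insert Cs z≤n earlier r) (step y-in)
    where
    step : ∀ {y} → Seen y ⊎ y ∈ x ∷ xs → (Seen y ⊎ y ≡ x) ⊎ y ∈ xs
    step (inj₁ s)           = inj₁ (inj₁ s)
    step (inj₂ (here refl)) = inj₁ (inj₂ refl)
    step (inj₂ (there y∈))  = inj₂ y∈
    earlier : ∀ {y} → γ y < γ x → ¬ FinPoset.Comparable P x y → Seen y
    earlier lt _ with cover (here refl) lt
    ... | inj₁ s           = s
    ... | inj₂ (here refl) = contradiction lt (<-irrefl refl)
    ... | inj₂ (there y∈)  = contradiction (All.lookup le y∈) (<⇒≱ lt)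

  firstFit-colours : (∀ {x y} → x Fin.< y → γ x ≤ γ y) → ∀ x → γ x < length (firstFit P idₚ)
  firstFit-colours sorted x = foldl-colours (tabulate id) {[]} {λ _ → ⊥} (AllPairsₚ.tabulate⁺-< sorted)
    (λ _ _ → inj₂ (∈-allFin _)) (λ ()) (inj₂ (∈-allFin x))

-- Series decomposition along a map to a chain.

restrict : ∀ {m n} → FinPoset n → (e : Fin m → Fin n) → (∀ {x y} → e x ≡ e y → x ≡ y) → FinPoset m
restrict Q e e-injective = record
  { _≼_ = λ x y → e x ≼ e y
  ; isDecPartialOrder = record
    { isPartialOrder = record
      { isPreorder = record { isEquivalence = isEquivalence ; reflexive = λ { refl → Q.refl } ; trans = Q.trans }
      ; antisym    = λ p q → e-injective (Q.antisym p q) }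
    ; _≟_  = Fin._≟_
    ; _≤?_ = λ x y → e x ≼? e y } }
  where
  open FinPoset Q
  module Q = IsDecPartialOrder isDecPartialOrder

module _ {n K : ℕ} (Q : FinPoset n) (g : Fin n → Fin K)
         (mono  : ∀ {x y} → FinPoset._≼_ Q x y → g x Fin.≤ g y)
         (cross : ∀ {x y} → g x Fin.< g y → FinPoset._≼_ Q x y) where

  In-fibre? : ∀ i → Decidable₁ (λ x → g x ≡ i)
  In-fibre? i x = g x Fin.≟ i

  fibre : Fin K → List (Fin n)
  fibre i = filter (In-fibre? i) (allFin n)

  fibre-size : Fin K → ℕ
  fibre-size i = length (fibre i)

  include : ∀ i → Fin (fibre-size i) → Fin n
  include i = lookup (fibre i)

  include-injective : ∀ i {x y} → include i x ≡ include i y → x ≡ y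
  include-injective i = Unique-lookup-injective (AllPairsₚ.filter⁺ (In-fibre? i) (allFin⁺ n))

  g-include : ∀ i x → g (include i x) ≡ i
  g-include i x = proj₂ (∈-filter⁻ (In-fibre? i) {xs = allFin n} (∈-lookup x))

  fibrePoset : ∀ i → FinPoset (fibre-size i)
  fibrePoset i = restrict Q (include i) (include-injective i)

  -- By `mono` and `cross` the order between different fibres is that of their indices, so Q is the
  -- series composition of its fibres.
  𝒬-fibres : (∀ i → 𝒬 (fibrePoset i)) → 𝒬 Q
  𝒬-fibres qs = series fibrePoset qs (glue , record
    { isOrderMonomorphism = record
      { isOrderHomomorphism = record { cong = cong glue ; mono = glue-mono }
      ; injective = glue-injective
      ; cancel    = λ {a} {b} → glue-cancel {a} {b} }
    ; surjective = λ y → (g y , Any.index (in-fibre y)) , λ { refl → sym (Anyₚ.lookup-index (in-fibre y)) } })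
    where
    open FinPoset Q using (_≼_)
    glue : Cell fibre-size → Fin n
    glue (i , x) = include i x
    in-fibre : ∀ y → y ∈ fibre (g y)
    in-fibre y = ∈-filter⁺ (In-fibre? (g y)) (∈-allFin y) refl
    glue-mono : ∀ {a b} → SeriesOrder fibrePoset a b → glue a ≼ glue b
    glue-mono (within p)                     = p
    glue-mono (across {i} {j} {x} {y} i<j)   = cross (subst₂ Fin._<_ (sym (g-include i x)) (sym (g-include j y)) i<j)
    glue-injective : ∀ {a b} → glue a ≡ glue b → a ≡ b
    glue-injective {i , x} {j , y} eq with trans (sym (g-include i x)) (trans (cong g eq) (g-include j y))
    ... | refl = cong (i ,_) (include-injective i eq)
    glue-cancel : ∀ {a b} → glue a ≼ glue b → SeriesOrder fibrePoset a b
    glue-cancel {i , x} {j , y} p with m≤n⇒m<n∨m≡n (subst₂ Fin._≤_ (g-include i x) (g-include j y) (mono p))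
    ... | inj₁ i<j = across i<j
    ... | inj₂ eq with Finₚ.toℕ-injective eq
    ... | refl = within p

m<o+n⇒m∸n<o : ∀ {m n o} → n ≤ m → m < o + n → m ∸ n < o
m<o+n⇒m∸n<o {n = n} {o} n≤m lt = +-cancelʳ-< n _ o (subst (_< o + n) (sym (m∸n+n≡m n≤m)) lt)

-- The staged posets and their width.

-- The posets of the lower bound: the colouring of Staged w uses ω w = 2 ^ w ∸ 1 colours.
data Staged : ℕ → Set where
  copy : ∀ {w} → Fin (suc (ω w)) → Staged w → Staged (suc w)
  rail : ∀ {w} → Fin (suc (ω w)) → Staged (suc w)

infix 4 _⊑ˢ_ _⊑ˢ?_

data _⊑ˢ_ : ∀ {w} → Rel (Staged w) 0ℓ where
  inside-copy : ∀ {w i} {a b : Staged w} → a ⊑ˢ b → copy i a ⊑ˢ copy i b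
  series-copy : ∀ {w i j} {a b : Staged w} → i Fin.< j → copy i a ⊑ˢ copy j b
  climb       : ∀ {w i j} {a : Staged w} → i Fin.< j → copy i a ⊑ˢ rail j
  along       : ∀ {w} {i j : Fin (suc (ω w))} → i Fin.≤ j → _⊑ˢ_ {suc w} (rail i) (rail j)

⊑ˢ-refl : ∀ {w} {a : Staged w} → a ⊑ˢ a
⊑ˢ-refl {a = copy i a} = inside-copy ⊑ˢ-refl
⊑ˢ-refl {a = rail j}   = along ≤-refl

⊑ˢ-trans : ∀ {w} {a b c : Staged w} → a ⊑ˢ b → b ⊑ˢ c → a ⊑ˢ c
⊑ˢ-trans (inside-copy p) (inside-copy q) = inside-copy (⊑ˢ-trans p q)
⊑ˢ-trans (inside-copy p) (series-copy q) = series-copy q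
⊑ˢ-trans (inside-copy p) (climb q)       = climb q
⊑ˢ-trans (series-copy p) (inside-copy q) = series-copy p
⊑ˢ-trans (series-copy p) (series-copy q) = series-copy (<-trans p q)
⊑ˢ-trans (series-copy p) (climb q)       = climb (<-trans p q)
⊑ˢ-trans (climb p)       (along q)       = climb (≤-trans p q)
⊑ˢ-trans (along p)       (along q)       = along (≤-trans p q)

⊑ˢ-antisym : ∀ {w} {a b : Staged w} → a ⊑ˢ b → b ⊑ˢ a → a ≡ b
⊑ˢ-antisym (inside-copy p) (inside-copy q) = cong (copy _) (⊑ˢ-antisym p q)
⊑ˢ-antisym (inside-copy p) (series-copy q) = contradiction q (<-irrefl refl)
⊑ˢ-antisym (series-copy p) (inside-copy q) = contradiction p (<-irrefl refl)
⊑ˢ-antisym (series-copy p) (series-copy q) = contradiction q (<-asym p)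
⊑ˢ-antisym (along p)       (along q)       = cong rail (Finₚ.toℕ-injective (≤-antisym p q))

_⊑ˢ?_ : ∀ {w} → Decidable (_⊑ˢ_ {w})
copy i a ⊑ˢ? copy j b with Finₚ.<-cmp i j
... | tri< i<j _ _    = yes (series-copy i<j)
... | tri> _ i≢j j<i  = no λ { (inside-copy _) → i≢j refl ; (series-copy i<j) → <-asym i<j j<i }
... | tri≈ i≮j refl _ with a ⊑ˢ? b
...   | yes p = yes (inside-copy p)
...   | no ¬p = no λ { (inside-copy p) → ¬p p ; (series-copy i<i) → i≮j i<i }
copy i a ⊑ˢ? rail j with i Fin.<? j
... | yes p = yes (climb p)
... | no ¬p = no λ { (climb p) → ¬p p }
rail i ⊑ˢ? copy j a = no λ ()
rail i ⊑ˢ? rail j with i Fin.≤? j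
... | yes p = yes (along p)
... | no ¬p = no λ { (along p) → ¬p p }

stagedOrder : ∀ w → DecPreorder (Staged w)
stagedOrder w = record { _≼_ = _⊑ˢ_ ; ≼-refl = ⊑ˢ-refl ; ≼-trans = ⊑ˢ-trans ; _≼?_ = _⊑ˢ?_ }

enumerate : ∀ w → List (Staged w)
enumerate zero    = []
enumerate (suc w) = cartesianProductWith copy (allFin (suc (ω w))) (enumerate w) ++ map rail (allFin (suc (ω w)))

∈-enumerate : ∀ {w} (a : Staged w) → a ∈ enumerate w
∈-enumerate (copy i a) = ∈-++⁺ˡ (∈-cartesianProductWith⁺ copy (∈-allFin i) (∈-enumerate a))
∈-enumerate {suc w} (rail j) = ∈-++⁺ʳ (cartesianProductWith copy (allFin (suc (ω w))) (enumerate w)) (∈-map⁺ rail (∈-allFin j))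

enumerate-unique : ∀ w → Unique (enumerate w)
enumerate-unique zero    = []
enumerate-unique (suc w) = ++⁺ (cartesianProductWith⁺ copy (λ { refl → refl , refl }) (allFin⁺ _) (enumerate-unique w))
  (map⁺ (λ { refl → refl }) (allFin⁺ _)) disjoint
  where
  disjoint : ∀ {a} → ¬ (a ∈ cartesianProductWith copy (allFin (suc (ω w))) (enumerate w) × a ∈ map rail (allFin (suc (ω w))))
  disjoint (a∈ , a∈′) with ∈-cartesianProductWith⁻ copy (allFin (suc (ω w))) (enumerate w) a∈ | ∈-map⁻ rail a∈′
  ... | _ , _ , _ , _ , refl | _ , _ , ()

module _ {w : ℕ} where
  open DecPreorder (stagedOrder (suc w)) using (_∥_)
  open DecPreorder (stagedOrder w) using () renaming (_∥_ to _∥′_)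

  contents : List (Staged (suc w)) → List (Staged w)
  contents []              = []
  contents (copy i a ∷ as) = a ∷ contents as
  contents (rail j ∷ as)   = contents as

  copy-∥⁻ : ∀ {i j : Fin (suc (ω w))} {a b} → copy i a ∥ copy j b → a ∥′ b
  copy-∥⁻ {i} {j} (p , q) with Finₚ.<-cmp i j
  ... | tri< i<j _ _  = contradiction (series-copy i<j) p
  ... | tri> _ _ j<i  = contradiction (series-copy j<i) q
  ... | tri≈ _ refl _ = (p ∘ inside-copy) , (q ∘ inside-copy)

  rails-comparable : ∀ (i j : Fin (suc (ω w))) → ¬ (rail i ∥ rail j)
  rails-comparable i j (p , q) = [ p ∘ along , q ∘ along ]′ (≤-total (toℕ i) (toℕ j))

  contents-∥ : ∀ {i : Fin (suc (ω w))} {a} as → All (copy i a ∥_) as → All (a ∥′_) (contents as)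
  contents-∥ []              []       = []
  contents-∥ (copy j b ∷ as) (p ∷ ps) = copy-∥⁻ p ∷ contents-∥ as ps
  contents-∥ (rail j ∷ as)   (p ∷ ps) = contents-∥ as ps

  contents-antichain : ∀ as → AllPairs _∥_ as → AllPairs _∥′_ (contents as)
  contents-antichain []              []       = []
  contents-antichain (copy j b ∷ as) (p ∷ ps) = contents-∥ as p ∷ contents-antichain as ps
  contents-antichain (rail j ∷ as)   (p ∷ ps) = contents-antichain as ps

  no-second-rail : ∀ {i} as → All (rail i ∥_) as → length as ≡ length (contents as)
  no-second-rail []              []       = refl
  no-second-rail (copy j b ∷ as) (p ∷ ps) = cong suc (no-second-rail as ps)
  no-second-rail {i} (rail j ∷ as) (p ∷ ps) = contradiction p (rails-comparable i j)

  -- Rails form a chain, and elements of different copies are comparable. An antichain thus has at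
  -- most one rail, and the rest projects to an antichain one stage down.
  one-rail : ∀ as → AllPairs _∥_ as → length as ≤ suc (length (contents as))
  one-rail []              []       = z≤n
  one-rail (copy j b ∷ as) (p ∷ ps) = s≤s (one-rail as ps)
  one-rail (rail j ∷ as)   (p ∷ ps) = s≤s (≤-reflexive (no-second-rail as p))

staged-width : ∀ w {S} → DecPreorder.Width (stagedOrder w) S w
staged-width zero    []       _ _  = z≤n
staged-width zero    (() ∷ _)
staged-width (suc w) as       _ ps = ≤-trans (one-rail as ps)
  (s≤s (staged-width w {λ _ → ⊤} (contents as) (All.universal (λ _ → tt) _) (contents-antichain as ps)))

wide : ∀ w → List (Staged w)
wide zero    = []
wide (suc w) = rail Fin.zero ∷ map (copy Fin.zero) (wide w)

length-wide : ∀ w → length (wide w) ≡ w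
length-wide zero    = refl
length-wide (suc w) = cong suc (trans (length-map _ (wide w)) (length-wide w))

wide-antichain : ∀ w → AllPairs (DecPreorder._∥_ (stagedOrder w)) (wide w)
wide-antichain zero    = []
wide-antichain (suc w) =
  Allₚ.map⁺ (All.universal (λ a → (λ ()) , λ { (climb ()) }) (wide w)) ∷
  AllPairsₚ.map⁺ (AllPairs.map (λ (p , q) → (λ { (inside-copy r) → p r ; (series-copy ()) }) ,
                                             λ { (inside-copy r) → q r ; (series-copy ()) }) (wide-antichain w))

-- The greedy colouring of the staged posets.

-- Copy i avoids the colours ω w − i, …, ω w − 1 of the rails 1, …, i incomparable to it; rail 0
-- is incomparable to all copies and sees every colour.
colour : ∀ {w} → Staged w → ℕ
colour {suc w} (copy i a) with colour a + toℕ i <? ω w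
... | yes _ = colour a
... | no _  = colour a + toℕ i
colour {suc w} (rail Fin.zero)    = ω w + ω w
colour {suc w} (rail (Fin.suc j)) = ω w ∸ suc (toℕ j)

colour-copy-low : ∀ {w} i (a : Staged w) → colour a + toℕ i < ω w → colour (copy i a) ≡ colour a
colour-copy-low {w} i a lt with colour a + toℕ i <? ω w
... | yes _ = refl
... | no ¬p = contradiction lt ¬p

colour-copy-high : ∀ {w} i (a : Staged w) → ω w ≤ colour a + toℕ i → colour (copy i a) ≡ colour a + toℕ i
colour-copy-high {w} i a le with colour a + toℕ i <? ω w
... | yes p = contradiction p (≤⇒≯ le)
... | no _  = refl

colour< : ∀ {w} (a : Staged w) → colour a < ω w
colour< {suc w} (copy i a) with colour a + toℕ i <? ω w
... | yes _ = s≤s (≤-trans (<⇒≤ (colour< a)) (m≤m+n (ω w) (ω w)))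
... | no _  = s≤s (+-mono-≤ (<⇒≤ (colour< a)) (≤-pred (Finₚ.toℕ<n i)))
colour< {suc w} (rail Fin.zero)    = ≤-refl
colour< {suc w} (rail (Fin.suc j)) = s≤s (≤-trans (m∸n≤m (ω w) (suc (toℕ j))) (m≤m+n (ω w) (ω w)))

-- For j > 0 rail j has colour ω w - j. If i ≥ j, an unshifted colour c of copy i satisfies c + i <
-- ω w and is smaller, while shifted colours are at least ω w. The colour of rail 0 exceeds those of
-- all copies.
copy-rail-colours : ∀ {w} (i j : Fin (suc (ω w))) (a : Staged w) → ¬ i Fin.< j → colour (copy i a) ≢ colour (rail j)
copy-rail-colours {w} i Fin.zero a _ eq with colour a + toℕ i <? ω w
... | yes p = <⇒≢ (≤-trans (colour< a) (m≤m+n (ω w) (ω w))) eq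
... | no _  = <⇒≢ (+-mono-<-≤ (colour< a) (≤-pred (Finₚ.toℕ<n i))) eq
copy-rail-colours {w} i (Fin.suc j) a i≮j eq with colour a + toℕ i <? ω w
... | yes p = <⇒≱ p (≤-trans (≤-reflexive (sym (trans (cong (_+ suc (toℕ j)) eq) (m∸n+n≡m (Finₚ.toℕ<n j)))))
                             (+-monoʳ-≤ (colour a) (≮⇒≥ i≮j)))
... | no ¬p = ¬p (≤-trans (s≤s (≤-reflexive eq)) (≤-trans (≤-reflexive (sym (+-∸-assoc 1 (Finₚ.toℕ<n j)))) (m∸n≤m (ω w) (toℕ j))))

colour-proper : ∀ {w} (a b : Staged w) → colour a ≡ colour b → a ⊑ˢ b ⊎ b ⊑ˢ a
colour-proper (rail i) (rail j) _ = [ inj₁ ∘ along , inj₂ ∘ along ]′ (≤-total (toℕ i) (toℕ j))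
colour-proper (copy i a) (rail j) eq with i Fin.<? j
... | yes p = inj₁ (climb p)
... | no ¬p = contradiction eq (copy-rail-colours i j a ¬p)
colour-proper (rail j) (copy i a) eq with i Fin.<? j
... | yes p = inj₂ (climb p)
... | no ¬p = contradiction (sym eq) (copy-rail-colours i j a ¬p)
colour-proper {suc w} (copy i a) (copy j b) eq with Finₚ.<-cmp i j
... | tri< i<j _ _  = inj₁ (series-copy i<j)
... | tri> _ _ j<i  = inj₂ (series-copy j<i)
... | tri≈ _ refl _ with colour a + toℕ i <? ω w | colour b + toℕ i <? ω w
... | yes _ | yes _ = [ inj₁ ∘ inside-copy , inj₂ ∘ inside-copy ]′ (colour-proper a b eq)
... | no _  | no _  = [ inj₁ ∘ inside-copy , inj₂ ∘ inside-copy ]′ (colour-proper a b (+-cancelʳ-≡ (toℕ i) _ _ eq))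
... | yes p | no ¬q = contradiction (≤-trans (s≤s (≤-trans (≤-reflexive (sym eq)) (m≤m+n (colour a) (toℕ i)))) p) ¬q
... | no ¬p | yes q = contradiction (≤-trans (s≤s (≤-trans (≤-reflexive eq) (m≤m+n (colour b) (toℕ i)))) q) ¬p

copy-∥⁺ : ∀ {w i} {a b : Staged w} → ¬ a ⊑ˢ b → ¬ b ⊑ˢ a → DecPreorder._∥_ (stagedOrder (suc w)) (copy i a) (copy i b)
copy-∥⁺ p q = (λ { (inside-copy r) → p r ; (series-copy i<i) → <-irrefl refl i<i }) ,
              (λ { (inside-copy r) → q r ; (series-copy i<i) → <-irrefl refl i<i })

Onto Greedy : ℕ → Set
Onto w   = ∀ {l} → l < ω w → ∃[ a ] colour {w} a ≡ l
Greedy w = ∀ (a : Staged w) {l} → l < colour a → ∃[ b ] colour b ≡ l × DecPreorder._∥_ (stagedOrder w) a b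

greedy-step : ∀ w → Onto w → Greedy w → Greedy (suc w)
greedy-step w onto greedy (rail Fin.zero) {l} lt with l <? ω w
... | yes l<ω with onto l<ω
-- Copy 0 keeps every colour.
...   | b , refl = copy Fin.zero b , colour-copy-low Fin.zero b (subst (_< ω w) (sym (+-identityʳ _)) l<ω) ,
                   (λ ()) , λ { (climb ()) }
-- The last copy, with index ω w, shifts every colour by ω w.
greedy-step w onto greedy (rail Fin.zero) {l} lt | no l≮ω with onto {l ∸ ω w} (m<o+n⇒m∸n<o (≮⇒≥ l≮ω) lt)
...   | b , eq = copy last b ,
                 trans (colour-copy-high last b (subst (ω w ≤_) (sym sum) (≮⇒≥ l≮ω))) sum ,
                 (λ ()) , λ { (climb ()) }
  where
  last : Fin (suc (ω w))
  last = Fin.fromℕ (ω w)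
  sum : colour b + toℕ last ≡ l
  sum = trans (cong₂ _+_ eq (Finₚ.toℕ-fromℕ (ω w))) (m∸n+n≡m (≮⇒≥ l≮ω))
greedy-step w onto greedy (rail (Fin.suc j)) {l} lt with onto {l} (≤-trans lt (m∸n≤m (ω w) (suc (toℕ j))))
... | b , refl = copy (Fin.suc j) b , colour-copy-low (Fin.suc j) b (subst (colour b + suc (toℕ j) <_) (m∸n+n≡m (Finₚ.toℕ<n j)) (+-monoˡ-< (suc (toℕ j)) lt)) ,
                 (λ ()) , λ { (climb j<j) → <-irrefl refl j<j }
greedy-step w onto greedy (copy i a) {l} lt with colour a + toℕ i <? ω w
... | yes low with greedy a lt
...   | b , refl , p , q = copy i b , colour-copy-low i b (<-trans (+-monoˡ-< (toℕ i) lt) low) , copy-∥⁺ p q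
greedy-step w onto greedy (copy i a) {l} lt | no ¬low with l + toℕ i <? ω w
... | yes low with greedy a {l} (+-cancelʳ-< (toℕ i) l (colour a) (≤-trans low (≮⇒≥ ¬low)))
...   | b , refl , p , q = copy i b , colour-copy-low i b low , copy-∥⁺ p q
greedy-step w onto greedy (copy i a) {l} lt | no ¬low | no high with l <? ω w
... | no l≮ω with greedy a {l ∸ toℕ i} (m<o+n⇒m∸n<o (≤-trans (≤-pred (Finₚ.toℕ<n i)) (≮⇒≥ l≮ω)) lt)
...   | b , eq , p , q = copy i b , trans (colour-copy-high i b (subst (ω w ≤_) (sym sum) (≮⇒≥ l≮ω))) sum , copy-∥⁺ p q
  where
  sum : colour b + toℕ i ≡ l
  sum = trans (cong (_+ toℕ i) eq) (m∸n+n≡m (≤-trans (≤-pred (Finₚ.toℕ<n i)) (≮⇒≥ l≮ω)))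
greedy-step w onto greedy (copy i a) {l} lt | no ¬low | no high | yes l<ω =
  -- The colours that copy i gives up, those from ω w - i to ω w - 1, are seen on the rails: rail ω
  -- w - l has colour l, and its index is at most i, so it does not lie above copy i.
  rail (Fin.suc j) ,
  trans (cong (λ t → ω w ∸ suc t) (Finₚ.toℕ-fromℕ< j<)) (trans (cong (ω w ∸_) (sym (+-∸-assoc 1 l<ω))) (m∸[m∸n]≡n (<⇒≤ l<ω))) ,
  (λ { (climb i<j) → <⇒≱ i<j (≤-trans (≤-reflexive (trans (cong suc (Finₚ.toℕ-fromℕ< j<)) (sym (+-∸-assoc 1 l<ω)))) (m≤n+o⇒m∸n≤o (ω w) l (≮⇒≥ high))) }) , λ ()
  where
  j< : ω w ∸ suc l < ω w
  j< = ≤-trans (≤-reflexive (sym (+-∸-assoc 1 l<ω))) (m∸n≤m (ω w) l)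
  j : Fin (ω w)
  j = Fin.fromℕ< j<

-- Rail 0 has the greatest colour, so greediness at rail 0 yields all the others.
onto-step : ∀ w → Greedy (suc w) → Onto (suc w)
onto-step w greedy {l} (s≤s l≤) with m≤n⇒m<n∨m≡n l≤
... | inj₁ lt   = let a , eq , _ = greedy (rail Fin.zero) lt in a , eq
... | inj₂ refl = rail Fin.zero , refl

colour-greedy : ∀ w → Onto w × Greedy w
colour-greedy zero    = (λ ()) , λ ()
colour-greedy (suc w) = let onto , greedy = colour-greedy w ; greedy′ = greedy-step w onto greedy in
                        onto-step w greedy′ , greedy′

-- Subposets of width 2 lie in 𝒬.

NoThreeAntichain : ∀ {n} → FinPoset n → Set
NoThreeAntichain Q = ∀ {x y z} → x ∥ y → y ∥ z → x ∥ z → ⊥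
  where open DecPreorder (posetOrder Q) using (_∥_)

-- Having no antichain of three elements passes to the fibres in the induction, whereas width
-- exactly 2 may be lost.
HasWidth-2⇒NoThreeAntichain : ∀ {n} (Q : FinPoset n) → HasWidth Q 2 → NoThreeAntichain Q
HasWidth-2⇒NoThreeAntichain Q hw {x} {y} {z} p q r =
  contradiction (HasWidth⇒Width Q {S = λ _ → ⊤} hw (x ∷ y ∷ z ∷ []) (All.universal (λ _ → tt) _)
    ((p ∷ r ∷ []) ∷ (q ∷ []) ∷ [] ∷ [])) λ { (s≤s (s≤s ())) }

IsCopy : ∀ {w} → Staged (suc w) → Set
IsCopy (copy _ _) = ⊤
IsCopy (rail _)   = ⊥

IsCopy? : ∀ {w} → Decidable₁ (IsCopy {w})
IsCopy? (copy _ _) = yes tt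
IsCopy? (rail _)   = no λ ()

inside-copy⁻ : ∀ {w i j} {a b : Staged w} → toℕ i ≡ toℕ j → copy i a ⊑ˢ copy j b → a ⊑ˢ b
inside-copy⁻ eq (inside-copy p) = p
inside-copy⁻ eq (series-copy p) = contradiction p (<-irrefl eq)

inside-copy⁺ : ∀ {w i j} {a b : Staged w} → toℕ i ≡ toℕ j → a ⊑ˢ b → copy i a ⊑ˢ copy j b
inside-copy⁺ eq p with Finₚ.toℕ-injective eq
... | refl = inside-copy p

-- With t the least index of a rail in Q, the copies before t are series components of Q.
-- The copies from t on lie beside rail t, so their elements form a chain, and together with
-- the rails they form a ladder-like top component.
module _ {w n : ℕ} (Q : FinPoset n) (f : Fin n → Staged (suc w))
         (mono : ∀ {x y} → FinPoset._≼_ Q x y → f x ⊑ˢ f y) (cancel : ∀ {x y} → f x ⊑ˢ f y → FinPoset._≼_ Q x y)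
         (no-three : NoThreeAntichain Q) where

  -- If Q has no rail, the default suc (ω w) exceeds all copy indices, and the top component is
  -- empty.
  AttainedAt : ℕ → Set
  AttainedAt t = t ≡ suc (ω w) ⊎ ∃[ x ] ∃[ j ] f x ≡ rail j × toℕ j ≡ t

  least-rail : ∀ xs → ∃[ t ] t ≤ suc (ω w) × (∀ {x j} → x ∈ xs → f x ≡ rail j → t ≤ toℕ j) × AttainedAt t
  least-rail []       = suc (ω w) , ≤-refl , (λ ()) , inj₁ refl
  least-rail (x ∷ xs) with least-rail xs | f x in eq
  ... | t , t≤ , least , att | copy i a =
    t , t≤ , (λ { (here refl) e → case trans (sym eq) e of λ () ; (there x∈) e → least x∈ e }) , att
  ... | t , t≤ , least , att | rail j with t ≤? toℕ j
  ... | yes le = t , t≤ , (λ { (here refl) e → case trans (sym eq) e of λ { refl → le } ; (there x∈) e → least x∈ e }) , att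
  ... | no ¬le = toℕ j , <⇒≤ (Finₚ.toℕ<n j) ,
    (λ { (here refl) e → case trans (sym eq) e of λ { refl → ≤-refl }
       ; (there x∈) e → ≤-trans (<⇒≤ (≰⇒> ¬le)) (least x∈ e) }) , inj₂ (x , j , eq , refl)

  t : ℕ
  t = proj₁ (least-rail (allFin n))

  t≤rails : ∀ {x j} → f x ≡ rail j → t ≤ toℕ j
  t≤rails = proj₁ (proj₂ (proj₂ (least-rail (allFin n)))) (∈-allFin _)

  t-attained : AttainedAt t
  t-attained = proj₂ (proj₂ (proj₂ (least-rail (allFin n))))

  -- Truncation at t merges the copies from t on with all rails into one top component.
  level : Staged (suc w) → ℕ
  level (copy i a) = toℕ i ⊓ t
  level (rail j)   = t

  level≤t : ∀ a → level a ≤ t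
  level≤t (copy i a) = m⊓n≤n (toℕ i) t
  level≤t (rail j)   = ≤-refl

  level-mono : ∀ {a b} → a ⊑ˢ b → level a ≤ level b
  level-mono (inside-copy _)     = ≤-refl
  level-mono (series-copy i<j)   = ⊓-monoˡ-≤ t (<⇒≤ i<j)
  level-mono (climb {i = i} _)   = m⊓n≤n (toℕ i) t
  level-mono (along _)           = ≤-refl

  level-low : ∀ (i : Fin (suc (ω w))) → toℕ i ⊓ t < t → toℕ i ⊓ t ≡ toℕ i
  level-low i lt = m≤n⇒m⊓n≡m (≮⇒≥ λ t<i → <-irrefl (m≥n⇒m⊓n≡n (<⇒≤ t<i)) lt)

  level-cross : ∀ {x y} → level (f x) < level (f y) → f x ⊑ˢ f y
  level-cross {x} {y} lt with f x | f y in eq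
  ... | rail j   | b        = contradiction lt (≤⇒≯ (level≤t b))
  ... | copy i a | copy j b = series-copy (≤-trans (subst (_< toℕ j ⊓ t) (level-low i (≤-trans lt (m⊓n≤n (toℕ j) t))) lt) (m⊓n≤m (toℕ j) t))
  ... | copy i a | rail j   = climb (≤-trans (subst (_< t) (level-low i lt) lt) (t≤rails eq))

  component : Fin n → Fin (suc t)
  component x = Fin.fromℕ< (s≤s (level≤t (f x)))

  toℕ-component : ∀ x → toℕ (component x) ≡ level (f x)
  toℕ-component x = Finₚ.toℕ-fromℕ< (s≤s (level≤t (f x)))

  component-mono : ∀ {x y} → FinPoset._≼_ Q x y → component x Fin.≤ component y
  component-mono {x} {y} p = subst₂ _≤_ (sym (toℕ-component x)) (sym (toℕ-component y)) (level-mono (mono p))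

  component-cross : ∀ {x y} → component x Fin.< component y → FinPoset._≼_ Q x y
  component-cross {x} {y} lt = cancel (level-cross (subst₂ _<_ (toℕ-component x) (toℕ-component y) lt))

  private
    fib : ∀ i → FinPoset (fibre-size Q component component-mono component-cross i)
    fib = fibrePoset Q component component-mono component-cross

    inc : ∀ i → Fin (fibre-size Q component component-mono component-cross i) → Fin n
    inc = include Q component component-mono component-cross

  level-inc : ∀ i x → level (f (inc i x)) ≡ toℕ i
  level-inc i x = trans (sym (toℕ-component (inc i x))) (cong toℕ (g-include Q component component-mono component-cross i x))

  low-fibre : ∀ i → toℕ i < t → ∀ x → ∃[ j ] ∃[ a ] f (inc i x) ≡ copy j a × toℕ j ≡ toℕ i
  low-fibre i i<t x with f (inc i x) | level-inc i x
  ... | copy j a | eq = j , a , refl , trans (sym (level-low j (subst (_< t) (sym eq) i<t))) eq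
  ... | rail j   | eq = contradiction i<t (<-irrefl (sym eq))

  -- Two incomparable elements in copies from t on would form an antichain of three with a rail of
  -- index t.
  beside-rail-t : ∀ {x y} → IsCopy (f x) → t ≤ level (f x) → IsCopy (f y) → t ≤ level (f y) → FinPoset.Comparable Q x y
  beside-rail-t {x} {y} cx tx cy ty with FinPoset._≼?_ Q x y | FinPoset._≼?_ Q y x
  ... | yes p | _     = inj₁ p
  ... | no _  | yes q = inj₂ q
  ... | no ¬p | no ¬q with t-attained
  ... | inj₂ (r , j , eq , j≡t) = ⊥-elim (no-three (¬p , ¬q) (beside cy ty) (beside cx tx))
    where
    beside : ∀ {z} → IsCopy (f z) → t ≤ level (f z) → ¬ FinPoset._≼_ Q z r × ¬ FinPoset._≼_ Q r z
    beside {z} cz tz = (λ p → not-below (f z) cz tz (subst (f z ⊑ˢ_) eq (mono p))) , λ p → not-above (f z) cz (subst (_⊑ˢ f z) eq (mono p))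
      where
      not-below : ∀ a → IsCopy a → t ≤ level a → ¬ a ⊑ˢ rail j
      not-below (copy i a) _ le (climb i<j) = <⇒≱ i<j (≤-trans (≤-reflexive j≡t) (≤-trans le (m⊓n≤m (toℕ i) t)))
      not-above : ∀ a → IsCopy a → ¬ rail j ⊑ˢ a
      not-above (copy i a) _ ()
  ... | inj₁ t≡ = ⊥-elim (too-high (f x) cx tx)
    where
    too-high : ∀ a → IsCopy a → ¬ t ≤ level a
    too-high (copy i a) _ le = <⇒≱ (Finₚ.toℕ<n i) (≤-trans (≤-reflexive (sym t≡)) (≤-trans le (m⊓n≤m (toℕ i) t)))

  high-fibre : ∀ i → t ≤ toℕ i → LadderLike (fib i)
  high-fibre i t≤i = copies , chain-copies , chain-rails , ascending
    where
    In-copy? : Decidable₁ (λ x → IsCopy (f (inc i x)))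
    In-copy? x = IsCopy? (f (inc i x))
    copies : Subset _
    copies = fromList (filter In-copy? (allFin _))
    copies⁻ : ∀ {x} → x ∈ₛ copies → IsCopy (f (inc i x))
    copies⁻ x∈ = proj₂ (∈-filter⁻ In-copy? {xs = allFin _} (∈-fromList⁻ x∈))
    rails⁻ : ∀ {x} → x ∈ₛ ∁ copies → ¬ IsCopy (f (inc i x))
    rails⁻ x∈ c = x∈∁p⇒x∉p x∈ (∈-fromList⁺ (∈-filter⁺ In-copy? (∈-allFin _) c))
    high : ∀ x → t ≤ level (f (inc i x))
    high x = subst (t ≤_) (sym (level-inc i x)) t≤i
    chain-copies : FinPoset.IsChain (fib i) copies
    chain-copies x y x∈ y∈ = beside-rail-t (copies⁻ x∈) (high x) (copies⁻ y∈) (high y)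
    rails-chain : ∀ {w} (a b : Staged (suc w)) → ¬ IsCopy a → ¬ IsCopy b → a ⊑ˢ b ⊎ b ⊑ˢ a
    rails-chain (copy _ _) _          ¬c _  = contradiction tt ¬c
    rails-chain (rail _)   (copy _ _) _  ¬c = contradiction tt ¬c
    rails-chain (rail j)   (rail l)   _  _  = [ inj₁ ∘ along , inj₂ ∘ along ]′ (≤-total (toℕ j) (toℕ l))
    chain-rails : FinPoset.IsChain (fib i) (∁ copies)
    chain-rails x y x∈ y∈ = [ inj₁ ∘ cancel , inj₂ ∘ cancel ]′
      (rails-chain (f (inc i x)) (f (inc i y)) (rails⁻ x∈) (rails⁻ y∈))
    rail-not-below : ∀ {w} {a b : Staged (suc w)} → IsCopy a → ¬ IsCopy b → ¬ b ⊑ˢ a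
    rail-not-below {a = copy _ _} {copy _ _} _ ¬c _ = ¬c tt
    rail-not-below {a = copy _ _} {rail _}   _ _  ()
    ascending : ∀ x y → x ∈ₛ copies → y ∈ₛ ∁ copies → FinPoset.Comparable (fib i) x y → FinPoset._≺_ (fib i) x y
    ascending x y x∈ y∈ (inj₁ p) = p , λ { refl → rails⁻ y∈ (copies⁻ x∈) }
    ascending x y x∈ y∈ (inj₂ p) = contradiction (mono p) (rail-not-below (copies⁻ x∈) (rails⁻ y∈))

  Staged-suc-𝒬 : (∀ {m} (Q′ : FinPoset m) (f′ : Fin m → Staged w) → (∀ {x y} → FinPoset._≼_ Q′ x y → f′ x ⊑ˢ f′ y) →
                  (∀ {x y} → f′ x ⊑ˢ f′ y → FinPoset._≼_ Q′ x y) → NoThreeAntichain Q′ → 𝒬 Q′) → 𝒬 Q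
  Staged-suc-𝒬 ih = 𝒬-fibres Q component component-mono component-cross λ i → fibre-𝒬 i (toℕ i <? t)
    where
    fibre-𝒬 : ∀ i → Dec (toℕ i < t) → 𝒬 (fib i)
    fibre-𝒬 i (no ¬p)  = ladder (high-fibre i (≮⇒≥ ¬p))
    -- Such a fibre lies in a single copy, so forgetting the index maps it to the previous stage.
    fibre-𝒬 i (yes i<t) = ih (fib i) (λ x → proj₁ (proj₂ (low x)))
      (λ {x} {y} p → inside-copy⁻ (same x y) (subst₂ _⊑ˢ_ (shape x) (shape y) (mono p)))
      (λ {x} {y} p → cancel (subst₂ _⊑ˢ_ (sym (shape x)) (sym (shape y)) (inside-copy⁺ (same x y) p)))
      no-three
      where
      low = low-fibre i i<t
      shape : ∀ x → f (inc i x) ≡ copy (proj₁ (low x)) (proj₁ (proj₂ (low x)))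
      shape x = proj₁ (proj₂ (proj₂ (low x)))
      same : ∀ x y → toℕ (proj₁ (low x)) ≡ toℕ (proj₁ (low y))
      same x y = trans (proj₂ (proj₂ (proj₂ (low x)))) (sym (proj₂ (proj₂ (proj₂ (low y)))))

Staged-𝒬 : ∀ w {n} (Q : FinPoset n) (f : Fin n → Staged w) → (∀ {x y} → FinPoset._≼_ Q x y → f x ⊑ˢ f y) →
           (∀ {x y} → f x ⊑ˢ f y → FinPoset._≼_ Q x y) → NoThreeAntichain Q → 𝒬 Q
Staged-𝒬 zero    Q f _ _ _ = ladder (Data.Fin.Subset.⊥ , (λ x → absurd (f x)) , (λ x → absurd (f x)) , λ x → absurd (f x))
  where
  absurd : ∀ {A : Set} → Staged 0 → A
  absurd ()
Staged-𝒬 (suc w) Q f mono cancel no-three = Staged-suc-𝒬 Q f mono cancel no-three (Staged-𝒬 w)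

-- Presenting the staged posets to First-Fit.

module _ (w : ℕ) where
  open DecPreorder (stagedOrder w) using (_∥_)

  Colour? : ∀ c → Decidable₁ (λ (a : Staged w) → colour a ≡ c)
  Colour? c a = colour a ≟ c

  colourClass : ℕ → List (Staged w)
  colourClass c = filter (Colour? c) (enumerate w)

  -- Numbering the elements by increasing colour makes the identity permutation the required
  -- presentation order.
  presentation : List (Staged w)
  presentation = concat (map colourClass (upTo (ω w)))

  Earlier : Rel (Staged w) 0ℓ
  Earlier a b = colour a ≤ colour b × a ≢ b

  colour-class : ∀ {c a} → a ∈ colourClass c → colour a ≡ c
  colour-class {c} a∈ = proj₂ (∈-filter⁻ (Colour? c) {xs = enumerate w} a∈)

  presentation-sorted : AllPairs Earlier presentation
  presentation-sorted = AllPairsₚ.concat⁺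
    (Allₚ.map⁺ (All.universal (λ c → AllPairs-build
      (λ a∈ b∈ a≢b → ≤-reflexive (trans (colour-class a∈) (sym (colour-class b∈))) , a≢b)
      (AllPairsₚ.filter⁺ (Colour? c) (enumerate-unique w))) (upTo (ω w))))
    (AllPairsₚ.map⁺ (AllPairsₚ.applyUpTo⁺₁ id (ω w) λ {i} {j} i<j _ →
      All.tabulate λ a∈ → All.tabulate λ b∈ →
        let lt = subst₂ _<_ (sym (colour-class a∈)) (sym (colour-class b∈)) i<j
        in <⇒≤ lt , λ { refl → <-irrefl refl lt }))

  ∈-presentation : ∀ a → a ∈ presentation
  ∈-presentation a = ∈-concat⁺′ (∈-filter⁺ (Colour? (colour a)) (∈-enumerate a) refl) (∈-map⁺ colourClass (∈-upTo⁺ (colour< a)))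

  at : Fin (length presentation) → Staged w
  at = lookup presentation

  at-injective : ∀ {x y} → at x ≡ at y → x ≡ y
  at-injective = Unique-lookup-injective (AllPairs.map proj₂ presentation-sorted)

  position : Staged w → Fin (length presentation)
  position a = Any.index (∈-presentation a)

  at-position : ∀ a → at (position a) ≡ a
  at-position a = sym (Anyₚ.lookup-index (∈-presentation a))

  stagedPoset : FinPoset (length presentation)
  stagedPoset = record
    { _≼_ = λ x y → at x ⊑ˢ at y
    ; isDecPartialOrder = record
      { isPartialOrder = record
        { isPreorder = record { isEquivalence = isEquivalence ; reflexive = λ { refl → ⊑ˢ-refl } ; trans = ⊑ˢ-trans }
        ; antisym    = λ p q → at-injective (⊑ˢ-antisym p q) }
      ; _≟_  = Fin._≟_
      ; _≤?_ = λ x y → at x ⊑ˢ? at y } }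

  stagedPoset-width : HasWidth stagedPoset w
  stagedPoset-width = attains , bounded
    where
    positions : AllPairs (DecPreorder._∥_ (posetOrder stagedPoset)) (map position (wide w))
    positions = AllPairsₚ.map⁺ (AllPairs.map (λ {a} {b} → subst₂ _∥_ (sym (at-position a)) (sym (at-position b))) (wide-antichain w))
    attains : ∃[ A ] FinPoset.IsAntichain stagedPoset A × ∣ A ∣ ≡ w
    attains = let anti , len = antichain-fromList stagedPoset positions in
              fromList (map position (wide w)) , anti , trans len (trans (length-map position (wide w)) (length-wide w))
    bounded : ∀ A → FinPoset.IsAntichain stagedPoset A → ∣ A ∣ ≤ w
    bounded A anti = subst (_≤ w) (trans (length-map at (elements A)) (length-elements A))
      (staged-width w {λ _ → ⊤} (map at (elements A)) (All.universal (λ _ → tt) _)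
        (AllPairsₚ.map⁺ (AllPairs-build (λ x∈ y∈ x≢y → let ¬c = anti _ _ (∈-elements⁻ x∈) (∈-elements⁻ y∈) x≢y in
          (¬c ∘ inj₁) , (¬c ∘ inj₂)) (elements-unique A))))

  stagedPoset-firstFit : ω w ≤ length (firstFit stagedPoset idₚ)
  stagedPoset-firstFit = all<⇒≤ λ l<ω → let a , eq = proj₁ (colour-greedy w) l<ω in
    subst (_< length (firstFit stagedPoset idₚ)) (trans (cong colour (at-position a)) eq)
      (firstFit-colours stagedPoset (colour ∘ at) (λ {x} {y} → colour-proper (at x) (at y)) greedy
        (λ x<y → proj₁ (AllPairs-lookup-< presentation-sorted x<y)) (position a))
    where
    all<⇒≤ : ∀ {m n} → (∀ {l} → l < m → l < n) → m ≤ n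
    all<⇒≤ {zero}  _ = z≤n
    all<⇒≤ {suc m} h = h ≤-refl
    greedy : ∀ x {l} → l < colour (at x) → ∃[ y ] colour (at y) ≡ l × ¬ FinPoset.Comparable stagedPoset x y
    greedy x lt = let b , eq , p , q = proj₂ (colour-greedy w) (at x) lt in
      position b , trans (cong colour (at-position b)) eq ,
      [ p ∘ subst (at x ⊑ˢ_) (at-position b) , q ∘ subst (_⊑ˢ at x) (at-position b) ]′

lower-bound : ∀ n (Q : FinPoset n) → HasWidth Q 2 → ¬ 𝒬 Q → ∀ w → (2 ^ w ∸ 1) ≤FF[ w , Q ]
lower-bound n Q hw ¬q w = attained (stagedPoset w) idₚ (stagedPoset-width w)
  (λ (f , iso) → let open IsOrderMonomorphism iso in
    ¬q (Staged-𝒬 w Q (at w ∘ f) mono cancel (HasWidth-2⇒NoThreeAntichain Q hw)))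
  (subst (_≤ length (firstFit (stagedPoset w) idₚ)) (cong (_∸ 1) (1+ω≡2^ w)) (stagedPoset-firstFit w))

theorem8 : (∃[ K ] (∀ (n : ℕ) (Q : FinPoset n) → HasWidth Q 2 → 𝒬 Q →
    ∃[ C ] (C ≤ K * n ×
    (∀ (w : ℕ) → 1 ≤ w → ∀ (m : ℕ) → m ≤FF[ w , Q ] → m ≤2^[ C ·lg² w ]))))
    × (∀ (n : ℕ) (Q : FinPoset n) → HasWidth Q 2 → ¬ 𝒬 Q →
    ∀ (w : ℕ) → 1 ≤ w → (2 ^ w ∸ 1) ≤FF[ w , Q ])
theorem8 = (52 , λ n Q _ q → 52 * n , ≤-refl , upper-bound n Q q) , λ n Q hw ¬q w _ → lower-bound n Q hw ¬q w
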